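{- Let $k\leq n-2$ and $m\geq1$, or let $k=n-1$ and $m\geq2$. If $G$ is minor maximal amongst graphs with $n$ vertices, at most $m$ parallel edges between any given pair of vertices, and spectator floor $k$, then $G$ is an $m$-saturated crowded $(n-k)$-parade.
   Context: All graphs are finite, have at least one vertex, have no loops, and may have multiple (parallel) edges. A minor of $H$ is any graph obtained from $H$ by a sequence of: deleting an isolated vertex, deleting an edge, contracting an edge that has no edge parallel to it. A graph $G$ in a class $\mathcal{C}$ is minor maximal in $\mathcal{C}$ if no graph in $\mathcal{C}$ other than $G$ has $G$ as a minor. A unique shortest path is a shortest $u$–$v$ path $P$ such that every $u$–$v$ path with the same number of vertices is identical to $P$, where two paths with different edge sequences are different even if their vertex sequences agree; a single vertex is a unique shortest path. The parade number $\mathrm{usp}(G)$ is the largest number of vertices of a unique shortest path in $G$; a parade is a unique shortest path with $\mathrm{usp}(G)$ vertices. The spectator number is $\mathrm{sp}(G)=|V(G)|-\mathrm{usp}(G)$. The spectator floor $\lfloor \mathrm{sp}\rfloor(G)$ is the minimum of $\mathrm{sp}(H)$ over all graphs $H$ of which $G$ is a minor. For $p\geq2$, a crowded $p$-parade is a graph $G$ with a parade $P$ of $p$ vertices such that (i) every vertex outside $P$ is adjacent to exactly two vertices of $P$, and those two vertices are adjacent to each other; (ii) any two vertices outside $P$ that are adjacent to a common vertex of $P$ are adjacent to each other. An $m$-saturated crowded $p$-parade ($p\geq 2$) is a crowded $p$-parade in which every edge not in the parade has exactly $m$ parallel copies (including itself). A crowded $1$-parade is a graph whose simplification is complete; an $m$-saturated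 crowded $1$-parade is a graph in which every pair of vertices is joined by exactly $m$ edges. -}

module Defs where

open import Data.Empty using (⊥)
open import Data.Fin.Base using (Fin; toℕ; punchIn)
open import Data.List.Base using (List; []; _∷_; length)
open import Data.List.Membership.Propositional using (_∈_; _∉_)
open import Data.List.Relation.Unary.Unique.Propositional using (Unique)
open import Data.Nat.Base using (ℕ; zero; suc; _+_; _∸_; _≤_; _<_; NonZero)
open import Data.Product.Base using (Σ-syntax; ∃-syntax; _×_)
open import Data.Sum.Base using (_⊎_)
open import Function.Bundles using (_↔_; module Inverse)
open import Level using (0ℓ)
open import Relation.Binary.Construct.Closure.ReflexiveTransitive
  using (Star; ε; _◅_)
open import Relation.Binary.Core using (Rel)
open import Relation.Binary.PropositionalEquality using (_≡_; _≢_)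
open import Relation.Nullary.Negation.Core using (¬_)

-- A loopless multigraph on the vertex set Fin n, given by the number of
-- parallel edges joining each pair of vertices.
record Graph (n : ℕ) : Set where
  field
    nonEmpty : NonZero n
    mult     : Fin n → Fin n → ℕ
    mult-sym : ∀ u v → mult u v ≡ mult v u
    loopless : ∀ u → mult u u ≡ 0

open Graph public

-- The individual edges joining u and v, numbered from 0.  The i-th element
-- of Edge G u v and the i-th element of Edge G v u are the same undirected
-- edge, traversed in opposite directions.
Edge : ∀ {n} → Graph n → Fin n → Fin n → Set
Edge G u v = Fin (mult G u v)

Adjacent : ∀ {n} → Graph n → Fin n → Fin n → Set
Adjacent G u v = 0 < mult G u v

SamePair : ∀ {n} (u v x y : Fin n) → Set
SamePair u v x y = (u ≡ x × v ≡ y) ⊎ (u ≡ y × v ≡ x)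

infix 4 _≅_ _≼_

record _≅_ {n n′} (G : Graph n) (H : Graph n′) : Set where
  field
    vertices↔ : Fin n ↔ Fin n′
    mult-≡    : ∀ u v →
      mult H (Inverse.to vertices↔ u) (Inverse.to vertices↔ v) ≡ mult G u v

-- MinorStep G H: the graph H results from G by a single operation.
data MinorStep : ∀ {n n′} → Graph n → Graph n′ → Set where

  delete-vertex : ∀ {n} {G : Graph (suc n)} {H : Graph n} (v : Fin (suc n)) →
    (∀ w → ¬ Adjacent G v w) →
    (∀ i j → mult H i j ≡ mult G (punchIn v i) (punchIn v j)) →
    MinorStep G H

  delete-edge : ∀ {n} {G H : Graph n} (u v : Fin n) →
    mult G u v ≡ suc (mult H u v) →
    (∀ i j → ¬ SamePair i j u v → mult H i j ≡ mult G i j) →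
    MinorStep G H

  -- Contracts the only edge between v and punchIn v w.  The vertex i of H
  -- is the vertex punchIn v i of G, except that w is the merged vertex.
  contract : ∀ {n} {G : Graph (suc n)} {H : Graph n} (v : Fin (suc n)) (w : Fin n) →
    mult G v (punchIn v w) ≡ 1 →
    (∀ i j → i ≢ w → j ≢ w → mult H i j ≡ mult G (punchIn v i) (punchIn v j)) →
    (∀ j → j ≢ w →
      mult H w j ≡ mult G v (punchIn v j) + mult G (punchIn v w) (punchIn v j)) →
    MinorStep G H

-- H ≼ G: H is (up to isomorphism) a minor of G.
data _≼_ {h} (H : Graph h) : ∀ {n} → Graph n → Set where
  iso  : ∀ {n} {G : Graph n} → H ≅ G → H ≼ G
  step : ∀ {n n′} {G : Graph n} {G′ : Graph n′} → MinorStep G G′ → H ≼ G′ → H ≼ G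

MinorMaximal : (∀ {n} → Graph n → Set) → ∀ {n} → Graph n → Set
MinorMaximal C G = C G × (∀ {h} (H : Graph h) → C H → G ≼ H → H ≅ G)

-- Propositional equality of walks compares edge sequences, so it
-- distinguishes walks that use different parallel edges.
Walk : ∀ {n} → Graph n → Fin n → Fin n → Set
Walk G = Star (Edge G)

vertices : ∀ {n} {T : Rel (Fin n) 0ℓ} {u v} → Star T u v → List (Fin n)
vertices {u = u} ε       = u ∷ []
vertices {u = u} (_ ◅ P) = u ∷ vertices P

#vertices : ∀ {n} {T : Rel (Fin n) 0ℓ} {u v} → Star T u v → ℕ
#vertices P = length (vertices P)

IsPath : ∀ {n} {T : Rel (Fin n) 0ℓ} {u v} → Star T u v → Set
IsPath P = Unique (vertices P)

module _ {n} (G : Graph n) where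

  record IsUniqueShortestPath {u v} (P : Walk G u v) : Set where
    field
      isPath   : IsPath P
      shortest : ∀ (Q : Walk G u v) → IsPath Q → #vertices P ≤ #vertices Q
      unique   : ∀ (Q : Walk G u v) → IsPath Q → #vertices Q ≡ #vertices P → Q ≡ P

  record IsParade {u v} (P : Walk G u v) : Set where
    field
      isUniqueShortestPath : IsUniqueShortestPath P
      longest : ∀ {x y} (Q : Walk G x y) → IsUniqueShortestPath Q →
                #vertices Q ≤ #vertices P

  SameEdge : ∀ {u v x y} → Edge G u v → Edge G x y → Set
  SameEdge {u} {v} {x} {y} e f = SamePair u v x y × toℕ e ≡ toℕ f

  EdgeOf : ∀ {u v x y} → Walk G x y → Edge G u v → Set
  EdgeOf ε       e = ⊥
  EdgeOf (f ◅ P) e = SameEdge e f ⊎ EdgeOf P e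

  -- Conditions on the vertices outside the parade P.
  record IsCrowded {u v} (P : Walk G u v) : Set where
    field
      two-neighbours : ∀ x → x ∉ vertices P →
        ∃[ a ] ∃[ b ] a ∈ vertices P × b ∈ vertices P × a ≢ b
          × Adjacent G x a × Adjacent G x b
          × (∀ c → c ∈ vertices P → Adjacent G x c → c ≡ a ⊎ c ≡ b)
          × Adjacent G a b
      common-neighbour : ∀ x y → x ∉ vertices P → y ∉ vertices P → x ≢ y →
        ∀ c → c ∈ vertices P → Adjacent G x c → Adjacent G y c → Adjacent G x y

  -- An edge between a and b has mult G a b parallel copies, itself included.
  IsSaturated : ∀ {u v} → ℕ → Walk G u v → Set
  IsSaturated m P = ∀ {a b} (e : Edge G a b) → ¬ EdgeOf P e → mult G a b ≡ m

-- Crowded p-parades are defined only for p ≥ 1.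
SaturatedCrowdedParade : ∀ {n} → ℕ → ℕ → Graph n → Set
SaturatedCrowdedParade m 0 G = ⊥
SaturatedCrowdedParade m 1 G = ∀ u v → u ≢ v → mult G u v ≡ m
SaturatedCrowdedParade m p@(suc (suc _)) G =
  ∃[ u ] ∃[ v ] Σ[ P ∈ Walk G u v ]
    IsParade G P × #vertices P ≡ p × IsCrowded G P × IsSaturated G m P

-- usp, sp and ⌊sp⌋ are given as functional relations, as they are extrema of
-- sets of natural numbers.  The truncated ∸ is harmless: p ≤ n for every path.
HasParadeNumber : ∀ {n} → Graph n → ℕ → Set
HasParadeNumber G p =
  ∃[ u ] ∃[ v ] Σ[ P ∈ Walk G u v ] IsParade G P × #vertices P ≡ p

HasSpectatorNumber : ∀ {n} → Graph n → ℕ → Set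
HasSpectatorNumber {n} G s = ∃[ p ] HasParadeNumber G p × s ≡ n ∸ p

HasSpectatorFloor : ∀ {n} → Graph n → ℕ → Set
HasSpectatorFloor G k =
  (∃[ h ] Σ[ H ∈ Graph h ] G ≼ H × HasSpectatorNumber H k)
  × (∀ {h} (H : Graph h) s → G ≼ H → HasSpectatorNumber H s → k ≤ s)

-- Graphs with n vertices, at most m parallel edges between any pair of
-- vertices, and spectator floor k.
InClass : (n m k : ℕ) → ∀ {n′} → Graph n′ → Set
InClass n m k {n′} G = n′ ≡ n × (∀ u v → mult G u v ≤ m) × HasSpectatorFloor G k

{-# OPTIONS --safe #-}

-- Let G have spectator floor k, attained by H with a parade P on p vertices.
-- Put the vertices of P at the odd positions 1, 3, …, 2p-1 in order, and a
-- vertex off P at the even position 2d, where d is its distance to an end of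
-- P, truncated at p.  Since P is the unique shortest path, adjacent vertices
-- have positions at most 2 apart.  Identifying the positions 2i, 2i+1 and
-- 2i+2 is 1-Lipschitz and shortens the path by one vertex; for a suitable i
-- this accommodates the deletion of a vertex or the contraction of an edge,
-- so the minor G of H has such a layout with n-k vertices on the path.
-- Joining any two vertices of G whose positions are at most 2 apart, by one
-- edge if both are on the path and by m edges otherwise, gives a saturated
-- crowded (n-k)-parade X with G ≼ X.  A unique shortest path of X on more than n-k vertices would
-- contradict the spectator floor of G, so X lies in the class of G, and
-- X ≅ G by maximality.

module Submission where

open import Defs
open import Data.Empty using (⊥)
open import Data.Fin.Base as Fin using (Fin; zero; suc; toℕ; fromℕ<; punchIn; punchOut)
open import Data.Fin.Properties as Fin using (any?; injective⇒≤; punchIn-injective; punchIn-punchOut; punchInᵢ≢i)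
open import Data.Fin.Permutation using (↔⇒≡)
open import Data.List.Base using (List; []; _∷_; lookup; allFin; cartesianProduct)
open import Data.List.Membership.Propositional using (_∈_; _∉_)
open import Data.List.Membership.Propositional.Properties using (∈-lookup; ∈-allFin; ∈-cartesianProduct⁺)
import Data.List.Membership.DecPropositional as DecMembership
open import Data.List.Relation.Unary.All as All using ([]; _∷_)
open import Data.List.Relation.Unary.All.Properties using (¬Any⇒All¬)
open import Data.List.Relation.Unary.Any using (here; there)
open import Data.List.Relation.Unary.AllPairs using ([]; _∷_)
open import Data.List.Relation.Unary.Unique.Propositional using (Unique)
open import Data.Nat.Base using (ℕ; zero; suc; pred; _+_; _*_; _∸_; _≤_; _<_; z≤n; s≤s; >-nonZero)
open import Data.Nat.Properties
open import Data.Product.Base using (Σ-syntax; ∃-syntax; _×_; _,_; proj₁; proj₂)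
open import Data.Sum.Base using (_⊎_; inj₁; inj₂; [_,_]′)
open import Function.Base using (_∘_; id)
open import Function.Bundles using (_↔_; module Injection; module Inverse)
open import Function.Construct.Identity using (↔-id)
open import Function.Construct.Symmetry using (↔-sym)
open import Function.Properties.Inverse using (↔⇒↣)
open import Relation.Binary.Construct.Closure.ReflexiveTransitive using (ε; _◅_)
open import Relation.Binary.Definitions using (tri<; tri≈; tri>)
open import Relation.Binary.PropositionalEquality
open import Relation.Nullary.Decidable.Core using (Dec; yes; no; _×-dec_; _⊎-dec_)
open import Relation.Nullary.Negation.Core using (¬_; contradiction)

private variable
  n n′ : ℕ

-- Lists without repetition, finite sets and parity.

lookup-injective : ∀ {A : Set} {xs : List A} → Unique xs →
  ∀ {i j} → lookup xs i ≡ lookup xs j → i ≡ j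
lookup-injective (_ ∷ _)  {zero}  {zero}  _  = refl
lookup-injective (x∉ ∷ _) {zero}  {suc j} eq = contradiction eq (All.lookup x∉ (∈-lookup j))
lookup-injective (x∉ ∷ _) {suc i} {zero}  eq = contradiction (sym eq) (All.lookup x∉ (∈-lookup i))
lookup-injective (_ ∷ u)  {suc i} {suc j} eq = cong suc (lookup-injective u eq)

Fin-prop⇒≤1 : (∀ (i j : Fin n) → i ≡ j) → n ≤ 1
Fin-prop⇒≤1 {zero}        _ = z≤n
Fin-prop⇒≤1 {suc zero}    _ = ≤-refl
Fin-prop⇒≤1 {suc (suc n)} p = contradiction (p zero (suc zero)) λ ()

≤1⇒Fin-prop : n ≤ 1 → ∀ (i j : Fin n) → i ≡ j
≤1⇒Fin-prop (s≤s z≤n) zero zero = refl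

halve-≤ : ∀ {a b} → a * 2 ≤ suc (b * 2) → a ≤ b
halve-≤ {zero}          _             = z≤n
halve-≤ {suc a} {zero}  (s≤s ())
halve-≤ {suc a} {suc b} (s≤s (s≤s l)) = s≤s (halve-≤ l)

double-≤ : ∀ {a b} → a ≤ b → a * 2 ≤ b * 2
double-≤ z≤n     = z≤n
double-≤ (s≤s l) = s≤s (s≤s (double-≤ l))

odd≢even : ∀ i j → suc (i * 2) ≢ j * 2
odd≢even zero    (suc zero)    ()
odd≢even zero    (suc (suc j)) ()
odd≢even (suc i) (suc j) eq = odd≢even i j (cong (pred ∘ pred) eq)

double-injective : ∀ i j → i * 2 ≡ j * 2 → i ≡ j
double-injective i j eq = *-cancelʳ-≡ i j 2 eq

Parity : ℕ → Set
Parity x = (∃[ j ] x ≡ j * 2) ⊎ (∃[ j ] x ≡ suc (j * 2))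

parity : ∀ x → Parity x
parity zero          = inj₁ (0 , refl)
parity (suc zero)    = inj₂ (0 , refl)
parity (suc (suc x)) with parity x
... | inj₁ (j , eq) = inj₁ (suc j , cong (2 +_) eq)
... | inj₂ (j , eq) = inj₂ (suc j , cong (2 +_) eq)

-- Geodesics

module _ (G : Graph n) where

  open DecMembership (Fin._≟_ {n = n}) using (_∈?_)

  -- Competitors are arbitrary walks rather than paths, so tails and suffixes inherit the property
  -- at once. The two conversions below identify it with being a unique shortest path.
  Geodesic : ∀ {u v} → Walk G u v → Set
  Geodesic {u} {v} P = ∀ (W : Walk G u v) →
    #vertices P ≤ #vertices W × (#vertices W ≡ #vertices P → W ≡ P)

  0<#vertices : ∀ {u v} (P : Walk G u v) → 0 < #vertices P
  0<#vertices ε       = s≤s z≤n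
  0<#vertices (_ ◅ _) = s≤s z≤n

  start∈vertices : ∀ {u v} (P : Walk G u v) → u ∈ vertices P
  start∈vertices ε       = here refl
  start∈vertices (_ ◅ _) = here refl

  path-length : ∀ {u v} {P : Walk G u v} → IsPath P → #vertices P ≤ n
  path-length U = injective⇒≤ (lookup-injective U)

  suffix-path : ∀ {u v x} (P : Walk G u v) → IsPath P → x ∈ vertices P →
    Σ[ Q ∈ Walk G x v ] IsPath Q × #vertices Q ≤ #vertices P
  suffix-path ε       U       (here refl) = ε , U , ≤-refl
  suffix-path (e ◅ P) U       (here refl) = e ◅ P , U , ≤-refl
  suffix-path (e ◅ P) (_ ∷ U) (there x∈)  =
    let Q , UQ , le = suffix-path P U x∈ in Q , UQ , m≤n⇒m≤1+n le

  -- If the start recurs in the path obtained from the tail, the suffix from that recurrence omits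
  -- at least the first edge; hence the strict inequality.
  path-or-shorter : ∀ {u v} (W : Walk G u v) →
    IsPath W ⊎ (Σ[ Q ∈ Walk G u v ] IsPath Q × #vertices Q < #vertices W)
  path-or-shorter ε = inj₁ ([] ∷ [])
  path-or-shorter {u} (e ◅ W) with path-or-shorter W
  ... | inj₁ U with u ∈? vertices W
  ...   | yes u∈ = let Q , UQ , le = suffix-path W U u∈ in inj₂ (Q , UQ , s≤s le)
  ...   | no u∉  = inj₁ (¬Any⇒All¬ _ u∉ ∷ U)
  path-or-shorter {u} (e ◅ W) | inj₂ (Q , U , lt) with u ∈? vertices Q
  ...   | yes u∈ = let R , UR , le = suffix-path Q U u∈ in inj₂ (R , UR , m<n⇒m<1+n (≤-<-trans le lt))
  ...   | no u∉  = inj₂ (e ◅ Q , ¬Any⇒All¬ _ u∉ ∷ U , s≤s lt)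

  usp⇒geodesic : ∀ {u v} {P : Walk G u v} → IsUniqueShortestPath G P → Geodesic P
  usp⇒geodesic usp W with path-or-shorter W
  ... | inj₁ U            = IsUniqueShortestPath.shortest usp W U , IsUniqueShortestPath.unique usp W U
  ... | inj₂ (Q , U , lt) = <⇒≤ P<W , λ eq → contradiction (sym eq) (<⇒≢ P<W)
    where P<W = ≤-<-trans (IsUniqueShortestPath.shortest usp Q U) lt

  geodesic⇒usp : ∀ {u v} {P : Walk G u v} → Geodesic P → IsUniqueShortestPath G P
  geodesic⇒usp {P = P} geo = record
    { isPath   = isPath
    ; shortest = λ Q _ → proj₁ (geo Q)
    ; unique   = λ Q _ → proj₂ (geo Q)
    }
    where
    isPath : IsPath P
    isPath with path-or-shorter P
    ... | inj₁ U            = U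
    ... | inj₂ (Q , _ , lt) = contradiction (proj₁ (geo Q)) (<⇒≱ lt)

  ◅-injective : ∀ {u w v} {e f : Edge G u w} {P Q : Walk G w v} →
    _≡_ {A = Walk G u v} (e ◅ P) (f ◅ Q) → e ≡ f × P ≡ Q
  ◅-injective refl = refl , refl

  geodesic-tail : ∀ {u w v} {e : Edge G u w} {P : Walk G w v} → Geodesic (e ◅ P) → Geodesic P
  geodesic-tail {e = e} geo W =
    ≤-pred (proj₁ (geo (e ◅ W))) , λ eq → proj₂ (◅-injective (proj₂ (geo (e ◅ W)) (cong suc eq)))

  geodesic-suffix : ∀ {u v x} (P : Walk G u v) → Geodesic P → x ∈ vertices P →
    Σ[ S ∈ Walk G x v ] Geodesic S × #vertices S ≤ #vertices P
      × (∀ {y} → y ∈ vertices S → y ∈ vertices P)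
  geodesic-suffix ε       geo (here refl) = ε , geo , ≤-refl , id
  geodesic-suffix (e ◅ P) geo (here refl) = e ◅ P , geo , ≤-refl , id
  geodesic-suffix (e ◅ P) geo (there x∈)  =
    let S , geoS , le , sub = geodesic-suffix P (geodesic-tail geo) x∈
    in S , geoS , m≤n⇒m≤1+n le , there ∘ sub

-- Layouts

-- The path has p vertices, at the odd positions 1, 3, …, 2p-1; a vertex off
-- the path at position 2i lies beside the edge joining positions 2i-1 and
-- 2i+1.  The positions 0 and 2p beyond the ends spare all later
-- constructions the case distinction at the ends, and p may be 0.
record Layout (G : Graph n) (p : ℕ) : Set where
  field
    pos    : Fin n → ℕ
    onto   : ∀ {j} → j < p → ∃[ u ] pos u ≡ suc (j * 2)
    bound  : ∀ u → pos u ≤ p * 2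
    inj    : ∀ j {u v} → pos u ≡ suc (j * 2) → pos v ≡ suc (j * 2) → u ≡ v
    near   : ∀ {u v} → Adjacent G u v → pos u ≤ 2 + pos v
    simple : ∀ i j {u v} → u ≢ v → pos u ≡ suc (i * 2) → pos v ≡ suc (j * 2) → mult G u v ≤ 1

  odd-bound : ∀ j {u} → pos u ≡ suc (j * 2) → j < p
  odd-bound j {u} eq = halve-≤ (s≤s (subst (_≤ p * 2) eq (bound u)))

  near′ : ∀ {u v} → Adjacent G u v → pos v ≤ 2 + pos u
  near′ {u} {v} a = near (subst (0 <_) (mult-sym G u v) a)

  distinct : ∀ j {u v} → pos u ≡ suc (suc j * 2) → pos v ≡ suc (j * 2) → u ≢ v
  distinct j eq eq′ refl = 1+n≢n (double-injective (suc j) j (suc-injective (trans (sym eq) eq′)))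

-- Truncated distance to a fixed vertex.

module Depth (G : Graph n) (v : Fin n) where

  -- A walk with `suc t` vertices has t edges, so this bounds the distance to v by t.
  Within : ℕ → Fin n → Set
  Within t x = Σ[ W ∈ Walk G x v ] #vertices W ≤ suc t

  within? : ∀ t x → Dec (Within t x)
  within? t x with x Fin.≟ v
  ... | yes refl = yes (ε , s≤s z≤n)
  within? zero x | no x≢v = no λ where
    (ε , _)           → x≢v refl
    (e ◅ W , s≤s le)  → contradiction (0<#vertices G W) (≤⇒≯ le)
  within? (suc t) x | no x≢v with any? (λ y → (0 <? mult G x y) ×-dec within? t y)
  ... | yes (y , a , W , le) = yes (fromℕ< a ◅ W , s≤s le)
  ... | no none = no λ where
    (ε , _)          → x≢v refl
    (e ◅ W , s≤s le) → none (_ , ≤-<-trans z≤n (Fin.toℕ<n e) , W , le)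

  -- The distance from x to v, truncated at t.
  depth : ℕ → Fin n → ℕ
  depth zero    x = 0
  depth (suc t) x with within? t x
  ... | yes _ = depth t x
  ... | no  _ = suc t

  depth≤ : ∀ t x → depth t x ≤ t
  depth≤ zero    x = z≤n
  depth≤ (suc t) x with within? t x
  ... | yes _ = m≤n⇒m≤1+n (depth≤ t x)
  ... | no  _ = ≤-refl

  within⇒depth≤ : ∀ t {s x} → Within s x → depth t x ≤ s
  within⇒depth≤ zero    _ = z≤n
  within⇒depth≤ (suc t) {s} {x} (W , le) with within? t x
  ... | yes _ = within⇒depth≤ t (W , le)
  ... | no ¬w = ≰⇒> λ s≤t → ¬w (W , ≤-trans le (s≤s s≤t))

  -- Only a value strictly below t is sure to be a distance; the value t may come from the
  -- truncation.
  depth<⇒within : ∀ t x → depth t x < t → Within (depth t x) x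
  depth<⇒within (suc t) x lt with within? t x
  ... | no  _ = contradiction lt (<-irrefl refl)
  ... | yes (W , le) with depth t x ≟ t
  ...   | yes eq = W , subst (λ k → #vertices W ≤ suc k) (sym eq) le
  ...   | no neq = depth<⇒within t x (≤∧≢⇒< (≤-pred lt) neq)

  -- A walk realising the depth of y extends by the edge from x, unless y is at the cap t, which
  -- bounds every depth.
  depth-near : ∀ t {x y} → Adjacent G x y → depth t x ≤ suc (depth t y)
  depth-near t {x} {y} a with depth t y <? t
  ... | yes lt = let W , le = depth<⇒within t y lt in within⇒depth≤ t (fromℕ< a ◅ W , s≤s le)
  ... | no ≮t  = m≤n⇒m≤1+n (≤-trans (depth≤ t x) (≮⇒≥ ≮t))

-- The layout given by a unique shortest path.

module GeodesicLayout (G : Graph n) {u v : Fin n} (P : Walk G u v) (geo : Geodesic G P) where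

  open DecMembership (Fin._≟_ {n = n}) using (_∈?_)
  open Depth G v hiding (depth)

  private
    p = #vertices P
    depth = Depth.depth G v p

  -- The truncation at p is inactive here: S bounds the depth of x from above, so the depth is below
  -- p and some walk realises it, and S is no longer than that walk.
  depth-geodesic : ∀ {x} (S : Walk G x v) → Geodesic G S → #vertices S ≤ p → suc (depth x) ≡ #vertices S
  depth-geodesic {x} S geoS le = ≤-antisym upper lower
    where
    upper : suc (depth x) ≤ #vertices S
    upper with #vertices S in eq
    ... | zero  = contradiction (subst (0 <_) eq (0<#vertices G S)) λ ()
    ... | suc k = s≤s (within⇒depth≤ p (S , ≤-reflexive eq))
    lower : #vertices S ≤ suc (depth x)
    lower = let W , leW = depth<⇒within p x (≤-trans upper le) in ≤-trans (proj₁ (geoS W)) leW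

  suffix : ∀ {x} → x ∈ vertices P →
    Σ[ S ∈ Walk G x v ] Geodesic G S × suc (depth x) ≡ #vertices S
      × (∀ {y} → y ∈ vertices S → y ∈ vertices P)
  suffix x∈ = let S , geoS , le , sub = geodesic-suffix G P geo x∈ in
    S , geoS , depth-geodesic S geoS le , sub

  -- Along Q the depth falls by exactly one per vertex, from `#vertices Q` minus one down to 0 at v.
  depth-onto : ∀ {j x} (Q : Walk G x v) → Geodesic G Q → #vertices Q ≤ p →
    j < #vertices Q → ∃[ y ] y ∈ vertices Q × depth y ≡ j
  depth-onto {zero} ε geoQ le (s≤s z≤n) = _ , here refl , suc-injective (depth-geodesic ε geoQ le)
  depth-onto {suc j} ε geoQ le (s≤s ())
  depth-onto {j} (e ◅ Q) geoQ le lt with m≤n⇒m<n∨m≡n (≤-pred lt)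
  ... | inj₁ j<Q = let y , y∈ , eq = depth-onto Q (geodesic-tail G geoQ) (≤-trans (n≤1+n _) le) j<Q in
    y , there y∈ , eq
  ... | inj₂ j≡Q = _ , here refl , trans (suc-injective (depth-geodesic (e ◅ Q) geoQ le)) (sym j≡Q)

  depth-injective : ∀ {x y z} (Q : Walk G z v) → Geodesic G Q → #vertices Q ≤ p →
    x ∈ vertices Q → y ∈ vertices Q → depth x ≡ depth y → x ≡ y
  depth-injective ε _ _ (here refl) (here refl) _ = refl
  depth-injective (e ◅ Q) _ _ (here refl) (here refl) _ = refl
  depth-injective (e ◅ Q) geoQ le (there x∈) (there y∈) eq =
    depth-injective Q (geodesic-tail G geoQ) (≤-trans (n≤1+n _) le) x∈ y∈ eq
  depth-injective {x} {y} (e ◅ Q) geoQ le (here refl) (there y∈) eq =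
    contradiction eq (>⇒≢ (tail< Q geoQ le y∈))
    where
    tail< : ∀ {z w y} {e : Edge G z w} (Q : Walk G w v) → Geodesic G (e ◅ Q) → suc (#vertices Q) ≤ p →
      y ∈ vertices Q → depth y < depth z
    tail< {e = e} Q geoQ le y∈ =
      let S , geoS , leS , _ = geodesic-suffix G Q (geodesic-tail G geoQ) y∈ in
      ≤-pred (subst₂ _<_ (sym (depth-geodesic S geoS (≤-trans leS (≤-trans (n≤1+n _) le))))
        (sym (depth-geodesic (e ◅ Q) geoQ le)) (s≤s leS))
  depth-injective (e ◅ Q) geoQ le (there x∈) (here refl) eq =
    sym (depth-injective (e ◅ Q) geoQ le (here refl) (there x∈) (sym eq))

  -- Otherwise P could be rerouted through x without getting longer.
  outside-depth≥ : ∀ {x y} → x ∉ vertices P → y ∈ vertices P → Adjacent G y x → depth y ≤ depth x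
  outside-depth≥ {x} {y} x∉ y∈ a = ≮⇒≥ absurd
    where
    absurd : ¬ depth x < depth y
    absurd lt =
      let S , geoS , eqS , sub = suffix y∈
          W , leW = depth<⇒within p x (<-≤-trans lt (depth≤ p y))
          Q = fromℕ< a ◅ W
          Q≡S = proj₂ (geoS Q) (≤-antisym (≤-trans (s≤s (≤-trans leW lt)) (≤-reflexive eqS)) (proj₁ (geoS Q)))
      in x∉ (sub (subst (λ R → x ∈ vertices R) Q≡S (there (start∈vertices G W))))

  -- Every parallel edge from x to y, followed by the geodesic T, is a walk no longer than the
  -- geodesic S, hence equal to S. So all these edges coincide.
  simple-descent : ∀ {x y} → x ∈ vertices P → y ∈ vertices P → depth y < depth x → mult G x y ≤ 1
  simple-descent x∈ y∈ lt =
    let S , geoS , eqS , _ = suffix x∈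
        T , _ , eqT , _ = suffix y∈
        through = λ f → proj₂ (geoS (f ◅ T)) (≤-antisym
          (subst₂ (λ a b → suc a ≤ b) eqT eqS (s≤s lt)) (proj₁ (geoS (f ◅ T))))
    in Fin-prop⇒≤1 λ e f → proj₁ (◅-injective G (trans (through e) (sym (through f))))

  position : Fin n → ℕ
  position x with x ∈? vertices P
  ... | yes _ = suc (depth x * 2)
  ... | no  _ = depth x * 2

  position-∈ : ∀ {x} → x ∈ vertices P → position x ≡ suc (depth x * 2)
  position-∈ {x} x∈ with x ∈? vertices P
  ... | yes _ = refl
  ... | no x∉ = contradiction x∈ x∉

  position-odd : ∀ j {x} → position x ≡ suc (j * 2) → x ∈ vertices P × depth x ≡ j
  position-odd j {x} eq with x ∈? vertices P
  ... | yes x∈ = x∈ , double-injective (depth x) j (suc-injective eq)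
  ... | no _   = contradiction (sym eq) (odd≢even j (depth x))

  layout : Layout G p
  layout = record
    { pos    = position
    ; onto   = λ j<p → let y , y∈ , eq = depth-onto P geo ≤-refl j<p in
                 y , trans (position-∈ y∈) (cong (λ d → suc (d * 2)) eq)
    ; bound  = bound
    ; inj    = λ j eq eq′ → let x∈ , dx = position-odd j eq
                                y∈ , dy = position-odd j eq′ in
                 depth-injective P geo ≤-refl x∈ y∈ (trans dx (sym dy))
    ; near   = near
    ; simple = λ i j x≢y eq eq′ → simple x≢y (proj₁ (position-odd i eq)) (proj₁ (position-odd j eq′))
    }
    where
    bound : ∀ x → position x ≤ p * 2
    bound x with x ∈? vertices P
    ... | no _   = double-≤ (depth≤ p x)
    ... | yes x∈ = let S , _ , eqS , _ = suffix x∈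
                       _ , _ , le , _  = geodesic-suffix G P geo x∈ in
      ≤-trans (n≤1+n _) (double-≤ (≤-trans (≤-reflexive eqS) le))
    near : ∀ {x y} → Adjacent G x y → position x ≤ 2 + position y
    near {x} {y} a with x ∈? vertices P | y ∈? vertices P
    ... | yes _  | yes _  = s≤s (double-≤ (depth-near p a))
    ... | no _   | yes _  = m≤n⇒m≤1+n (double-≤ (depth-near p a))
    ... | no _   | no _   = double-≤ (depth-near p a)
    -- `depth-near` would only give `3 + depth y * 2`, one too many; the uniqueness of P, through
    -- `outside-depth≥`, saves it.
    ... | yes x∈ | no y∉  = s≤s (m≤n⇒m≤1+n (double-≤ (outside-depth≥ y∉ x∈ a)))
    simple : ∀ {x y} → x ≢ y → x ∈ vertices P → y ∈ vertices P → mult G x y ≤ 1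
    simple {x} {y} x≢y x∈ y∈ with <-cmp (depth x) (depth y)
    ... | tri> _ _ lt = simple-descent x∈ y∈ lt
    ... | tri< lt _ _ = subst (_≤ 1) (mult-sym G y x) (simple-descent y∈ x∈ lt)
    ... | tri≈ _ eq _ = contradiction (depth-injective P geo ≤-refl x∈ y∈ eq) x≢y

-- Minors of graphs with a layout

-- Identifies the positions 2i, 2i+1 and 2i+2, so that a vertex at the odd
-- position 2i+1 leaves the path.
collapse : ℕ → ℕ → ℕ
collapse zero    x             = x ∸ 2
collapse (suc i) (suc (suc x)) = 2 + collapse i x
collapse (suc i) x             = x

-- The increasing enumeration of the numbers other than i: path vertex j after the collapse was path
-- vertex `skip i j` before.
skip : ℕ → ℕ → ℕ
skip zero    j       = suc j
skip (suc i) zero    = zero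
skip (suc i) (suc j) = suc (skip i j)

skip≢ : ∀ i j → i ≢ skip i j
skip≢ (suc i) (suc j) eq = skip≢ i j (suc-injective eq)

skip-< : ∀ i {j p} → j < p → skip i j < suc p
skip-< zero    j<p                 = s≤s j<p
skip-< (suc i) {zero}  j<p         = s≤s z≤n
skip-< (suc i) {suc j} (s≤s j<p)   = s≤s (skip-< i j<p)

collapse-skip : ∀ i j → collapse i (suc (skip i j * 2)) ≡ suc (j * 2)
collapse-skip zero    j       = refl
collapse-skip (suc i) zero    = refl
collapse-skip (suc i) (suc j) = cong (2 +_) (collapse-skip i j)

-- The three identified positions land on the even position 2i, so an odd value can only come from a
-- surviving path position.
collapse-odd : ∀ i x j → collapse i x ≡ suc (j * 2) → x ≡ suc (skip i j * 2)
collapse-odd zero    (suc (suc x)) j       eq = cong (2 +_) eq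
collapse-odd (suc i) (suc zero)    zero    eq = refl
collapse-odd (suc i) (suc (suc x)) (suc j) eq =
  cong (2 +_) (collapse-odd i x j (suc-injective (suc-injective eq)))

collapse-≤ : ∀ i x → collapse i x ≤ x
collapse-≤ zero    x             = m∸n≤m x 2
collapse-≤ (suc i) zero          = ≤-refl
collapse-≤ (suc i) (suc zero)    = ≤-refl
collapse-≤ (suc i) (suc (suc x)) = s≤s (s≤s (collapse-≤ i x))

collapse-near : ∀ i x y → x ≤ 2 + y → collapse i x ≤ 2 + collapse i y
collapse-near zero    x             y             le = ≤-trans (∸-monoˡ-≤ 2 le) (m≤n+m∸n y 2)
collapse-near (suc i) zero          y             le = z≤n
collapse-near (suc i) (suc zero)    y             le = s≤s z≤n
collapse-near (suc i) (suc (suc x)) zero          (s≤s (s≤s le)) = s≤s (s≤s (≤-trans (collapse-≤ i x) le))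
collapse-near (suc i) (suc (suc x)) (suc zero)    (s≤s (s≤s le)) = s≤s (s≤s (≤-trans (collapse-≤ i x) le))
collapse-near (suc i) (suc (suc x)) (suc (suc y)) (s≤s (s≤s le)) = s≤s (s≤s (collapse-near i x y le))

collapse-bound : ∀ i x {p} → i ≤ p → x ≤ suc p * 2 → collapse i x ≤ p * 2
collapse-bound zero    x             i≤p       le = ∸-monoˡ-≤ 2 le
collapse-bound (suc i) zero          i≤p       le = z≤n
collapse-bound (suc i) (suc zero)    (s≤s i≤p) le = s≤s z≤n
collapse-bound (suc i) (suc (suc x)) (s≤s i≤p) (s≤s (s≤s le)) = s≤s (s≤s (collapse-bound i x i≤p le))

-- With `collapse-lower`: the positions within 2 of 2i+1 are sent between 2i-1 and 2i+1. Hence any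
-- two neighbours of the collapsed path vertex end up near each other, as its contraction requires.
collapse-upper : ∀ i x → x ≤ 2 + suc (i * 2) → collapse i x ≤ suc (i * 2)
collapse-upper zero    x             le = ∸-monoˡ-≤ 2 le
collapse-upper (suc i) zero          le = z≤n
collapse-upper (suc i) (suc zero)    le = s≤s z≤n
collapse-upper (suc i) (suc (suc x)) (s≤s (s≤s le)) = s≤s (s≤s (collapse-upper i x le))

collapse-lower : ∀ i x → suc (i * 2) ≤ 2 + x → i * 2 ≤ suc (collapse i x)
collapse-lower zero    x             le = z≤n
collapse-lower (suc i) (suc zero)    (s≤s (s≤s le)) = s≤s le
collapse-lower (suc i) (suc (suc x)) (s≤s (s≤s le)) = s≤s (s≤s (collapse-lower i x le))

collapse-even : ∀ i → collapse i (i * 2) ≡ collapse i (suc (i * 2))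
collapse-even zero    = refl
collapse-even (suc i) = cong (2 +_) (collapse-even i)

collapse-even⁺ : ∀ i → collapse i (suc i * 2) ≡ collapse i (suc (i * 2))
collapse-even⁺ zero    = refl
collapse-even⁺ (suc i) = cong (2 +_) (collapse-even⁺ i)

-- An even position within 2 of 2i+1 is 2i or 2i+2, and both are identified with it.
collapse-beside : ∀ i a → a * 2 ≤ 2 + suc (i * 2) → suc (i * 2) ≤ 2 + a * 2 →
  collapse i (a * 2) ≡ collapse i (suc (i * 2))
collapse-beside i a le ge with m≤n⇒m<n∨m≡n (halve-≤ {i} {a} (≤-pred ge))
... | inj₂ refl = collapse-even i
... | inj₁ i<a with ≤-antisym (halve-≤ {a} {suc i} le) i<a
...   | refl = collapse-even⁺ i

odd-near : ∀ {a b} → suc (a * 2) ≤ 2 + suc (b * 2) → a ≤ suc b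
odd-near le = halve-≤ (m≤n⇒m≤1+n (≤-pred le))

differ-by-one : ∀ {a b} → a ≢ b → a ≤ suc b → b ≤ suc a → a ≡ suc b ⊎ b ≡ suc a
differ-by-one {a} {b} a≢b a≤ b≤ with <-cmp a b
... | tri< lt _ _ = inj₂ (≤-antisym b≤ lt)
... | tri≈ _ eq _ = contradiction eq a≢b
... | tri> _ _ lt = inj₁ (≤-antisym a≤ lt)

-- Keeps contraction from creating parallel edges on the path: three path vertices are never
-- pairwise adjacent.
no-triangle : ∀ {a b c} → a ≢ b → b ≢ c → a ≢ c →
  a ≤ suc b → b ≤ suc a → b ≤ suc c → c ≤ suc b → a ≤ suc c → c ≤ suc a → ⊥
no-triangle a≢b b≢c a≢c ab ba bc cb ac ca with differ-by-one a≢b ab ba | differ-by-one b≢c bc cb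
... | inj₁ refl | inj₁ refl = 1+n≰n ac
... | inj₁ refl | inj₂ refl = a≢c refl
... | inj₂ refl | inj₁ refl = a≢c refl
... | inj₂ refl | inj₂ refl = 1+n≰n ca

-- Removes v while collapsing around path vertex i. By `v-leaves`, v is on no surviving path
-- position, so the other vertices still fill all p of them.
module Shrink {G : Graph (suc n)} {p} (L : Layout G (suc p)) (v : Fin (suc n)) {i} (i≤p : i ≤ p)
  (v-leaves : ∀ j → Layout.pos L v ≢ suc (skip i j * 2)) where

  open Layout L

  position : Fin n → ℕ
  position x = collapse i (pos (punchIn v x))

  shrink : (H : Graph n) →
    (∀ {x y} → Adjacent H x y → position x ≤ 2 + position y) →
    (∀ a b {x y} → x ≢ y → pos (punchIn v x) ≡ suc (skip i a * 2) →
      pos (punchIn v y) ≡ suc (skip i b * 2) → mult H x y ≤ 1) →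
    Layout H p
  shrink H near-H simple-H = record
    { pos    = position
    ; onto   = onto-H
    ; bound  = λ x → collapse-bound i _ i≤p (bound (punchIn v x))
    ; inj    = λ j eq eq′ → punchIn-injective v _ _
                 (inj (skip i j) (collapse-odd i _ j eq) (collapse-odd i _ j eq′))
    ; near   = near-H
    ; simple = λ a b x≢y eq eq′ → simple-H a b x≢y (collapse-odd i _ a eq) (collapse-odd i _ b eq′)
    }
    where
    onto-H : ∀ {j} → j < p → ∃[ x ] position x ≡ suc (j * 2)
    onto-H {j} j<p with onto (skip-< i j<p)
    ... | u , eq = punchOut v≢u ,
      trans (cong (collapse i) (trans (cong pos (punchIn-punchOut v≢u)) eq)) (collapse-skip i j)
      where
      v≢u : v ≢ u
      v≢u refl = v-leaves j eq

  delete-layout : {H : Graph n} →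
    (∀ x y → mult H x y ≡ mult G (punchIn v x) (punchIn v y)) → Layout H p
  delete-layout {H} mult-H = shrink H
    (λ {x} {y} a → collapse-near i _ _ (near (subst (0 <_) (mult-H x y) a)))
    (λ a b {x} {y} x≢y eq eq′ → subst (_≤ 1) (sym (mult-H x y))
      (simple (skip i a) (skip i b) (x≢y ∘ punchIn-injective v x y) eq eq′))

  -- The last hypothesis lets w inherit the neighbours of v: either v is the collapsed path vertex,
  -- whose neighbours become pairwise near, or v and w receive the same position.
  contract-layout : {H : Graph n} (w : Fin n) →
    mult G v (punchIn v w) ≡ 1 →
    (∀ x y → x ≢ w → y ≢ w → mult H x y ≡ mult G (punchIn v x) (punchIn v y)) →
    (∀ y → y ≢ w → mult H w y ≡ mult G v (punchIn v y) + mult G (punchIn v w) (punchIn v y)) →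
    pos v ≡ suc (i * 2) ⊎ collapse i (pos v) ≡ collapse i (pos (punchIn v w)) →
    Layout H p
  contract-layout {H} w vw≡1 mult-H mult-Hw merge = shrink H near-H simple-H
    where
    vw : Adjacent G v (punchIn v w)
    vw = subst (0 <_) (sym vw≡1) (s≤s z≤n)

    near-v : ∀ y → Adjacent G v (punchIn v y) →
      position w ≤ 2 + position y × position y ≤ 2 + position w
    near-v y vy = [ beside , merged ]′ merge
      where
      both : ∀ {x y} → pos v ≡ suc (i * 2) → Adjacent G v x → Adjacent G v y →
        collapse i (pos x) ≤ 2 + collapse i (pos y)
      both {x} {y} eq vx vy = ≤-trans
        (collapse-upper i (pos x) (subst (λ k → pos x ≤ 2 + k) eq (near′ vx)))
        (s≤s (collapse-lower i (pos y) (subst (_≤ 2 + pos y) eq (near vy))))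
      beside : pos v ≡ suc (i * 2) → position w ≤ 2 + position y × position y ≤ 2 + position w
      beside eq = both eq vw vy , both eq vy vw
      merged : collapse i (pos v) ≡ position w → position w ≤ 2 + position y × position y ≤ 2 + position w
      merged eq =
        subst (_≤ 2 + position y) eq (collapse-near i _ _ (near vy)) ,
        subst (λ k → position y ≤ 2 + k) eq (collapse-near i _ _ (near′ vy))

    near-w : ∀ y → y ≢ w → Adjacent H w y → position w ≤ 2 + position y × position y ≤ 2 + position w
    -- An edge at the merged vertex comes from v or, if v has none to y, from w.
    near-w y y≢w a with mult G v (punchIn v y) in eq
    ... | suc _ = near-v y (subst (0 <_) (sym eq) (s≤s z≤n))
    ... | zero  = collapse-near i _ _ (near wy) , collapse-near i _ _ (near′ wy)
      where
      wy : Adjacent G (punchIn v w) (punchIn v y)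
      wy = subst (0 <_) (trans (mult-Hw y y≢w) (cong (_+ mult G (punchIn v w) (punchIn v y)) eq)) a

    near-H : ∀ {x y} → Adjacent H x y → position x ≤ 2 + position y
    near-H {x} {y} a with x Fin.≟ w | y Fin.≟ w
    ... | yes refl | yes refl = m≤n+m _ 2
    ... | yes refl | no y≢w   = proj₁ (near-w y y≢w a)
    ... | no x≢w   | yes refl = proj₂ (near-w x x≢w (subst (0 <_) (mult-sym H x y) a))
    ... | no x≢w   | no y≢w   = collapse-near i _ _ (near (subst (0 <_) (mult-H x y x≢w y≢w) a))

    -- Contraction adds the multiplicities at v and at w. If v is the collapsed path vertex, two
    -- positive summands would make a triangle of path vertices. If instead v and w receive the same
    -- position, v would be on a surviving path position.
    simple-w : ∀ a b {y} → y ≢ w → pos (punchIn v w) ≡ suc (skip i a * 2) →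
      pos (punchIn v y) ≡ suc (skip i b * 2) → mult H w y ≤ 1
    simple-w a b {y} y≢w eq-w eq-y = subst (_≤ 1) (sym (mult-Hw y y≢w)) ([ sum≤1 , absurd ]′ merge)
      where
      y′ = punchIn v y
      w′ = punchIn v w

      close : ∀ {x z c d} → pos x ≡ suc (c * 2) → pos z ≡ suc (d * 2) → Adjacent G x z →
        c ≤ suc d × d ≤ suc c
      close {x} {z} ex ez a =
        odd-near (subst₂ (λ k l → k ≤ 2 + l) ex ez (near a)) ,
        odd-near (subst₂ (λ k l → k ≤ 2 + l) ez ex (near′ a))

      absurd : collapse i (pos v) ≡ position w → mult G v y′ + mult G w′ y′ ≤ 1
      absurd eq = contradiction
        (collapse-odd i (pos v) a (trans eq (trans (cong (collapse i) eq-w) (collapse-skip i a)))) (v-leaves a)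

      no-common : pos v ≡ suc (i * 2) → Adjacent G v y′ → ¬ Adjacent G w′ y′
      no-common eq-v vy wy =
        let vw₁ , vw₂ = close eq-v eq-w vw
            wy₁ , wy₂ = close eq-w eq-y wy
            vy₁ , vy₂ = close eq-v eq-y vy
        in no-triangle (skip≢ i a) (λ eq → y≢w (sym (punchIn-injective v w y
             (inj (skip i a) eq-w (trans eq-y (cong (λ k → suc (k * 2)) (sym eq)))))))
             (skip≢ i b) vw₁ vw₂ wy₁ wy₂ vy₁ vy₂

      sum≤1 : pos v ≡ suc (i * 2) → mult G v y′ + mult G w′ y′ ≤ 1
      sum≤1 eq-v with mult G v y′ in eq
      ... | zero  = simple (skip i a) (skip i b) (y≢w ∘ sym ∘ punchIn-injective v w y) eq-w eq-y
      ... | suc k = subst₂ (λ a b → a + b ≤ 1) eq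
        (sym (n≤0⇒n≡0 (≮⇒≥ (no-common eq-v (subst (0 <_) (sym eq) (s≤s z≤n))))))
        (subst (_≤ 1) (sym (+-identityʳ _)) (simple i (skip i b) (punchInᵢ≢i v y ∘ sym) eq-v eq-y))

    simple-H : ∀ a b {x y} → x ≢ y → pos (punchIn v x) ≡ suc (skip i a * 2) →
      pos (punchIn v y) ≡ suc (skip i b * 2) → mult H x y ≤ 1
    simple-H a b {x} {y} x≢y eq-x eq-y with x Fin.≟ w | y Fin.≟ w
    ... | yes refl | yes refl = contradiction refl x≢y
    ... | yes refl | no y≢w   = simple-w a b y≢w eq-x eq-y
    ... | no x≢w   | yes refl = subst (_≤ 1) (mult-sym H y x) (simple-w b a x≢w eq-y eq-x)
    ... | no x≢w   | no y≢w   = subst (_≤ 1) (sym (mult-H x y x≢w y≢w))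
      (simple (skip i a) (skip i b) (x≢y ∘ punchIn-injective v x y) eq-x eq-y)

leaves-odd : ∀ {x} i → x ≡ suc (i * 2) → ∀ j → x ≢ suc (skip i j * 2)
leaves-odd i eq j eq′ = skip≢ i j (double-injective i (skip i j) (suc-injective (trans (sym eq) eq′)))

leaves-even : ∀ {x} a → x ≡ a * 2 → ∀ i j → x ≢ suc (skip i j * 2)
leaves-even a eq i j eq′ = odd≢even (skip i j) a (trans (sym eq′) eq)

-- The path has to lose exactly one vertex whether or not v lies on it. A path vertex is collapsed
-- around itself.
delete-vertex-layout : ∀ {p} {G : Graph (suc n)} {H : Graph n} (v : Fin (suc n)) →
  (∀ x y → mult H x y ≡ mult G (punchIn v x) (punchIn v y)) →
  Layout G (suc p) → Layout H p
delete-vertex-layout v mult-H L with parity (Layout.pos L v)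
-- Off the path, v passes `v-leaves` for every collapse; the one at the first path vertex is chosen.
... | inj₁ (a , eq) = Shrink.delete-layout L v z≤n (leaves-even a eq 0) mult-H
... | inj₂ (i , eq) = Shrink.delete-layout L v (≤-pred (Layout.odd-bound L i eq)) (leaves-odd i eq) mult-H
-- The collapse is centred at v if v is on the path, otherwise at w if w is. If neither is, their
-- even positions agree or enclose a single path vertex, which becomes the centre.
contract-edge-layout : ∀ {p} {G : Graph (suc n)} {H : Graph n} (v : Fin (suc n)) (w : Fin n) →
  mult G v (punchIn v w) ≡ 1 →
  (∀ x y → x ≢ w → y ≢ w → mult H x y ≡ mult G (punchIn v x) (punchIn v y)) →
  (∀ y → y ≢ w → mult H w y ≡ mult G v (punchIn v y) + mult G (punchIn v w) (punchIn v y)) →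
  Layout G (suc p) → Layout H p
contract-edge-layout {p = p} {G} {H} v w vw≡1 mult-H mult-Hw L = result
  where
  open Layout L
  w′ = punchIn v w

  vw : Adjacent G v w′
  vw = subst (0 <_) (sym vw≡1) (s≤s z≤n)

  merge-at : ∀ i → i ≤ p → (∀ j → pos v ≢ suc (skip i j * 2)) →
    pos v ≡ suc (i * 2) ⊎ collapse i (pos v) ≡ collapse i (pos w′) → Layout H p
  merge-at i i≤p leaves = Shrink.contract-layout L v i≤p leaves w vw≡1 mult-H mult-Hw

  result : Layout H p
  result with parity (pos v) | parity (pos w′)
  ... | inj₂ (i , v≡i) | _ = merge-at i (≤-pred (odd-bound i v≡i)) (leaves-odd i v≡i) (inj₁ v≡i)
  ... | inj₁ (a , v≡a) | inj₂ (i , w≡i) =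
    merge-at i (≤-pred (odd-bound i w≡i)) (leaves-even a v≡a i)
      (inj₂ (trans (cong (collapse i) v≡a) (trans
        (collapse-beside i a (subst₂ (λ k l → k ≤ 2 + l) v≡a w≡i (near vw))
          (subst₂ (λ k l → k ≤ 2 + l) w≡i v≡a (near′ vw)))
        (cong (collapse i) (sym w≡i)))))
  ... | inj₁ (a , v≡a) | inj₁ (b , w≡b) with a ≟ b
  -- Equal positions stay equal under any collapse, so index 0 serves.
  ...   | yes refl = merge-at 0 z≤n (leaves-even a v≡a 0) (inj₂ (cong (collapse 0) (trans v≡a (sym w≡b))))
  ...   | no a≢b with differ-by-one a≢b
            (halve-≤ {a} {suc b} (m≤n⇒m≤1+n (subst₂ (λ k l → k ≤ 2 + l) v≡a w≡b (near vw))))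
            (halve-≤ {b} {suc a} (m≤n⇒m≤1+n (subst₂ (λ k l → k ≤ 2 + l) w≡b v≡a (near′ vw))))
  -- Here v and w sit at 2b+2 and 2b, on the two sides of path vertex b.
  ...     | inj₁ refl = merge-at b (≤-pred (halve-≤ (m≤n⇒m≤1+n (subst (_≤ suc p * 2) v≡a (bound v)))))
              (leaves-even a v≡a b)
              (inj₂ (trans (cong (collapse b) v≡a) (trans (collapse-even⁺ b)
                (trans (sym (collapse-even b)) (cong (collapse b) (sym w≡b))))))
  ...     | inj₂ refl = merge-at a (≤-pred (halve-≤ (m≤n⇒m≤1+n (subst (_≤ suc p * 2) w≡b (bound w′)))))
              (leaves-even a v≡a a)
              (inj₂ (trans (cong (collapse a) v≡a) (trans (collapse-even a)
                (trans (sym (collapse-even⁺ a)) (cong (collapse a) (sym w≡b))))))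

layout-⊆ : ∀ {p} {G : Graph n} {H : Graph n′} (f : Fin n′ ↔ Fin n) →
  (∀ x y → mult H x y ≤ mult G (Inverse.to f x) (Inverse.to f y)) → Layout G p → Layout H p
layout-⊆ {p = p} {G} {H} f mult≤ L = record
  { pos    = pos ∘ to
  ; onto   = λ j<p → let u , eq = onto j<p in from u , trans (cong pos (strictlyInverseˡ u)) eq
  ; bound  = bound ∘ to
  ; inj    = λ j eq eq′ → to-injective (inj j eq eq′)
  ; near   = λ a → near (<-≤-trans a (mult≤ _ _))
  ; simple = λ i j x≢y eq eq′ → ≤-trans (mult≤ _ _) (simple i j (x≢y ∘ to-injective) eq eq′)
  }
  where
  open Layout L
  open Inverse f
  open Injection (↔⇒↣ f) using () renaming (injective to to-injective)

zero-layout : (G : Graph n) → Layout G 0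
zero-layout G = record
  { pos    = λ _ → 0
  ; onto   = λ ()
  ; bound  = λ _ → z≤n
  ; inj    = λ _ ()
  ; near   = λ _ → z≤n
  ; simple = λ _ _ _ ()
  }

-- Once k exceeds n, the truncated difference is 0 and the empty layout serves.
layout-pred : ∀ k {G : Graph (suc n)} {H : Graph n} →
  (∀ {p} → Layout G (suc p) → Layout H p) → Layout G (suc n ∸ k) → Layout H (n ∸ k)
layout-pred {n} k {G} {H} f L with k ≤? n
... | yes k≤n = f (subst (Layout G) (+-∸-assoc 1 k≤n) L)
... | no k≰n  = subst (Layout H) (sym (m≤n⇒m∸n≡0 (≰⇒≥ k≰n))) (zero-layout H)

delete-edge-mult≤ : {G H : Graph n} (u v : Fin n) → mult G u v ≡ suc (mult H u v) →
  (∀ i j → ¬ SamePair i j u v → mult H i j ≡ mult G i j) → ∀ i j → mult H i j ≤ mult G i j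
delete-edge-mult≤ {G = G} {H} u v eq rest i j with i Fin.≟ u | j Fin.≟ v | i Fin.≟ v | j Fin.≟ u
... | yes refl | yes refl | _ | _ = ≤-trans (n≤1+n _) (≤-reflexive (sym eq))
... | _ | _ | yes refl | yes refl =
  subst₂ _≤_ (mult-sym H j i) (mult-sym G j i) (≤-trans (n≤1+n _) (≤-reflexive (sym eq)))
... | no i≢u | _ | no i≢v | _ = ≤-reflexive (rest i j λ where
  (inj₁ (i≡u , _)) → i≢u i≡u
  (inj₂ (i≡v , _)) → i≢v i≡v)
... | no i≢u | _ | _ | no j≢u = ≤-reflexive (rest i j λ where
  (inj₁ (i≡u , _)) → i≢u i≡u
  (inj₂ (_ , j≡u)) → j≢u j≡u)
... | _ | no j≢v | no i≢v | _ = ≤-reflexive (rest i j λ where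
  (inj₁ (_ , j≡v)) → j≢v j≡v
  (inj₂ (i≡v , _)) → i≢v i≡v)
... | _ | no j≢v | _ | no j≢u = ≤-reflexive (rest i j λ where
  (inj₁ (_ , j≡v)) → j≢v j≡v
  (inj₂ (_ , j≡u)) → j≢u j≡u)

-- The number k of vertices off the path is the invariant: operations that remove a vertex shorten
-- the path by one, and edge deletion leaves the layout as it is.
minor-layout : ∀ k {G : Graph n} {H : Graph n′} → H ≼ G → Layout G (n ∸ k) → Layout H (n′ ∸ k)
minor-layout k {G} {H} (iso f) L = subst (λ m → Layout H (m ∸ k)) (sym (↔⇒≡ (_≅_.vertices↔ f)))
  (layout-⊆ (_≅_.vertices↔ f) (λ x y → ≤-reflexive (sym (_≅_.mult-≡ f x y))) L)
minor-layout k (step (delete-vertex v _ mult-H) H≼) L =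
  minor-layout k H≼ (layout-pred k (delete-vertex-layout v mult-H) L)
minor-layout k {G} (step {G′ = G′} (delete-edge u v eq rest) H≼) L =
  minor-layout k H≼ (layout-⊆ (↔-id _) (delete-edge-mult≤ {G = G} {G′} u v eq rest) L)
minor-layout k (step (contract v w vw≡1 mult-H mult-Hw) H≼) L =
  minor-layout k H≼ (layout-pred k (contract-edge-layout v w vw≡1 mult-H mult-Hw) L)

-- Spanning subgraphs are minors

samePair? : (i j u v : Fin n) → Dec (SamePair i j u v)
samePair? i j u v = (i Fin.≟ u ×-dec j Fin.≟ v) ⊎-dec (i Fin.≟ v ×-dec j Fin.≟ u)

samePair-swap : {i j u v : Fin n} → SamePair i j u v → SamePair j i u v
samePair-swap (inj₁ (i≡u , j≡v)) = inj₂ (j≡v , i≡u)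
samePair-swap (inj₂ (i≡v , j≡u)) = inj₁ (j≡u , i≡v)

remove-edge : Graph n → Fin n → Fin n → Graph n
remove-edge {n} G u v = record
  { nonEmpty = nonEmpty G
  ; mult     = reduced
  ; mult-sym = reduced-sym
  ; loopless = reduced-loopless
  }
  where
  reduced : Fin n → Fin n → ℕ
  reduced i j with samePair? i j u v
  ... | yes _ = pred (mult G i j)
  ... | no  _ = mult G i j
  reduced-sym : ∀ i j → reduced i j ≡ reduced j i
  reduced-sym i j with samePair? i j u v | samePair? j i u v
  ... | yes _ | yes _ = cong pred (mult-sym G i j)
  ... | no _  | no _  = mult-sym G i j
  ... | yes s | no ¬s = contradiction (samePair-swap s) ¬s
  ... | no ¬s | yes s = contradiction (samePair-swap s) ¬s
  reduced-loopless : ∀ i → reduced i i ≡ 0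
  reduced-loopless i with samePair? i i u v
  ... | yes _ = cong pred (loopless G i)
  ... | no _  = loopless G i

remove-edge-same : (G : Graph n) {i j u v : Fin n} → SamePair i j u v →
  mult (remove-edge G u v) i j ≡ pred (mult G i j)
remove-edge-same G {i} {j} {u} {v} same with samePair? i j u v
... | yes _    = refl
... | no ¬same = contradiction same ¬same

remove-edge-other : (G : Graph n) {i j u v : Fin n} → ¬ SamePair i j u v →
  mult (remove-edge G u v) i j ≡ mult G i j
remove-edge-other G {i} {j} {u} {v} ¬same with samePair? i j u v
... | yes same = contradiction same ¬same
... | no _     = refl

≅-refl : (G : Graph n) → G ≅ G
≅-refl G = record { vertices↔ = ↔-id _ ; mult-≡ = λ _ _ → refl }

module _ (H : Graph n′) (K : Graph n) (H≅K : H ≅ K) where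

  private
    Dominated : Graph n → Set
    Dominated G = ∀ i j → mult K i j ≤ mult G i j

    DiffersIn : Graph n → List (Fin n × Fin n) → Set
    DiffersIn G ps = ∀ i j → mult K i j ≢ mult G i j → (i , j) ∈ ps

    -- Deletes surplus edges one at a time. `ps` lists the pairs that may still differ from K, and d
    -- in `remove-at` bounds the surplus at the head pair, so the recursion is structural in `ps`
    -- and d.
    remove-from : ∀ ps (G : Graph n) → Dominated G → DiffersIn G ps → H ≼ G
    remove-at : ∀ u v ps d (G : Graph n) → Dominated G → DiffersIn G ((u , v) ∷ ps) →
      mult G u v ≤ d + mult K u v → H ≼ G

    remove-from [] G K≤G diff = iso record
      { vertices↔ = vertices↔
      ; mult-≡    = λ x y → trans (sym (equal _ _)) (mult-≡ x y)
      }
      where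
      open _≅_ H≅K
      equal : ∀ i j → mult K i j ≡ mult G i j
      equal i j with mult K i j ≟ mult G i j
      ... | yes eq = eq
      ... | no neq = contradiction (diff i j neq) λ ()
    remove-from ((u , v) ∷ ps) G K≤G diff =
      remove-at u v ps (mult G u v) G K≤G diff (m≤m+n _ _)

    remove-at u v ps d G K≤G diff G≤ with mult K u v ≟ mult G u v
    remove-at u v ps d G K≤G diff G≤ | yes eq = remove-from ps G K≤G diff-tail
      where
      diff-tail : DiffersIn G ps
      diff-tail i j neq with diff i j neq
      ... | here refl = contradiction eq neq
      ... | there ∈ps = ∈ps
    remove-at u v ps zero G K≤G diff G≤ | no neq = contradiction (≤-antisym (K≤G u v) G≤) neq
    remove-at u v ps (suc d) G K≤G diff G≤ | no neq =
      step {G′ = G′} (delete-edge u v uv≡ (λ i j → remove-edge-other G))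
        (remove-at u v ps d G′ K≤G′ diff′ (≤-pred (subst (_≤ suc d + mult K u v) uv≡ G≤)))
      where
      G′ = remove-edge G u v
      K<G : ∀ {i j} → SamePair i j u v → mult K i j < mult G i j
      K<G (inj₁ (refl , refl)) = ≤∧≢⇒< (K≤G u v) neq
      K<G (inj₂ (refl , refl)) = subst₂ _<_ (mult-sym K u v) (mult-sym G u v) (≤∧≢⇒< (K≤G u v) neq)
      uv≡ : mult G u v ≡ suc (mult G′ u v)
      uv≡ = trans (sym (suc-pred _ ⦃ >-nonZero (≤-<-trans z≤n (K<G (inj₁ (refl , refl)))) ⦄))
        (cong suc (sym (remove-edge-same G (inj₁ (refl , refl)))))
      K≤G′ : Dominated G′
      K≤G′ i j with samePair? i j u v
      ... | yes same = <⇒≤pred (K<G same)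
      ... | no _     = K≤G i j
      diff′ : DiffersIn G′ ((u , v) ∷ ps)
      diff′ i j neq′ with samePair? i j u v
      ... | yes same = diff i j (<⇒≢ (K<G same))
      ... | no _     = diff i j neq′

  dominated⇒≼ : (G : Graph n) → (∀ i j → mult K i j ≤ mult G i j) → H ≼ G
  dominated⇒≼ G K≤G = remove-from (cartesianProduct (allFin n) (allFin n)) G K≤G
    (λ i j _ → ∈-cartesianProduct⁺ (∈-allFin i) (∈-allFin j))

relabel : {H : Graph n′} {G : Graph n} (f : Fin n′ ↔ Fin n) → Graph n
relabel {H = H} {G} f = record
  { nonEmpty = nonEmpty G
  ; mult     = λ i j → mult H (from i) (from j)
  ; mult-sym = λ i j → mult-sym H (from i) (from j)
  ; loopless = λ i → loopless H (from i)
  }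
  where open Inverse f

⊆⇒≼ : {H : Graph n′} {G : Graph n} (f : Fin n′ ↔ Fin n) →
  (∀ x y → mult H x y ≤ mult G (Inverse.to f x) (Inverse.to f y)) → H ≼ G
⊆⇒≼ {H = H} {G} f H≤G = dominated⇒≼ H (relabel {H = H} {G} f)
  (record { vertices↔ = f ; mult-≡ = λ x y → cong₂ (mult H) (strictlyInverseʳ x) (strictlyInverseʳ y) })
  G λ i j → subst₂ (λ a b → mult H (from i) (from j) ≤ mult G a b) (strictlyInverseˡ i) (strictlyInverseˡ j)
    (H≤G (from i) (from j))
  where open Inverse f

-- Only the isomorphism that ends the derivation changes: edge deletions and a new isomorphism
-- replace it.
⊆-≼-trans : {G H : Graph n} {K : Graph n′} → (∀ x y → mult G x y ≤ mult H x y) → H ≼ K → G ≼ K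
⊆-≼-trans G≤H (iso f) = ⊆⇒≼ (_≅_.vertices↔ f) λ x y →
  ≤-trans (G≤H x y) (≤-reflexive (sym (_≅_.mult-≡ f x y)))
⊆-≼-trans {G = G} G≤H (step s H≼) = step s (⊆-≼-trans {G = G} G≤H H≼)

-- Saturation

-- `linked` makes the path positions a walk, `filled` gives m edges to near pairs meeting an even
-- position, and `inner` puts each vertex off the path beside a path edge, which exists only from p
-- = 2 on.
record SaturatedLayout (m p : ℕ) (G : Graph n) : Set where
  field
    layout : Layout G p
  open Layout layout public
  field
    linked : ∀ j {u v} → pos u ≡ suc (suc j * 2) → pos v ≡ suc (j * 2) → Adjacent G u v
    filled : ∀ j {u v} → u ≢ v → pos u ≡ j * 2 → pos u ≤ 2 + pos v → pos v ≤ 2 + pos u → mult G u v ≡ m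
    inner  : 2 ≤ p → ∀ j {u} → pos u ≡ j * 2 → 0 < j × j < p

raise : ℕ → ℕ
raise zero    = 2
raise (suc x) = suc x

raise-near : ∀ {x y} → x ≤ 2 + y → raise x ≤ 2 + raise y
raise-near {zero}          le = s≤s (s≤s z≤n)
raise-near {suc x} {zero}  le = ≤-trans le (m≤m+n 2 2)
raise-near {suc x} {suc y} le = le

raise-odd : ∀ x j → raise x ≡ suc (j * 2) → x ≡ suc (j * 2)
raise-odd zero    j eq = contradiction (sym eq) (odd≢even j 1)
raise-odd (suc x) j eq = eq

raise≢0 : ∀ x → raise x ≢ 0
raise≢0 zero    ()
raise≢0 (suc x) ()

-- Sends all positions from 2q+2 on to 2q and fixes the others. With p = q+1 this moves the position
-- 2p beyond the last path vertex inwards, as `raise` does at the other end.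
lower : ℕ → ℕ → ℕ
lower zero    (suc (suc x)) = 0
lower (suc q) (suc (suc x)) = 2 + lower q x
lower _       x             = x

lower-≤ : ∀ q x → lower q x ≤ x
lower-≤ zero    zero          = z≤n
lower-≤ zero    (suc zero)    = ≤-refl
lower-≤ zero    (suc (suc x)) = z≤n
lower-≤ (suc q) zero          = z≤n
lower-≤ (suc q) (suc zero)    = ≤-refl
lower-≤ (suc q) (suc (suc x)) = s≤s (s≤s (lower-≤ q x))

lower-bound : ∀ q x → lower q x ≤ suc (q * 2)
lower-bound zero    zero          = z≤n
lower-bound zero    (suc zero)    = ≤-refl
lower-bound zero    (suc (suc x)) = z≤n
lower-bound (suc q) zero          = z≤n
lower-bound (suc q) (suc zero)    = s≤s z≤n
lower-bound (suc q) (suc (suc x)) = s≤s (s≤s (lower-bound q x))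

lower-near : ∀ q x y → x ≤ 2 + y → lower q x ≤ 2 + lower q y
lower-near zero    zero          y             le = z≤n
lower-near zero    (suc zero)    y             le = s≤s z≤n
lower-near zero    (suc (suc x)) y             le = z≤n
lower-near (suc q) zero          y             le = z≤n
lower-near (suc q) (suc zero)    y             le = s≤s z≤n
lower-near (suc q) (suc (suc x)) zero          (s≤s (s≤s le)) = s≤s (s≤s (≤-trans (lower-≤ q x) le))
lower-near (suc q) (suc (suc x)) (suc zero)    (s≤s (s≤s le)) = s≤s (s≤s (≤-trans (lower-≤ q x) le))
lower-near (suc q) (suc (suc x)) (suc (suc y)) (s≤s (s≤s le)) = s≤s (s≤s (lower-near q x y le))

lower-odd : ∀ q x j → lower q x ≡ suc (j * 2) → x ≡ suc (j * 2)
lower-odd zero    (suc zero)    j       eq = eq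
lower-odd (suc q) (suc zero)    j       eq = eq
lower-odd (suc q) (suc (suc x)) (suc j) eq = cong (2 +_) (lower-odd q x j (suc-injective (suc-injective eq)))

lower-fixes-odd : ∀ {q j} → j ≤ q → lower q (suc (j * 2)) ≡ suc (j * 2)
lower-fixes-odd {zero}  z≤n       = refl
lower-fixes-odd {suc q} z≤n       = refl
lower-fixes-odd {suc q} (s≤s j≤q) = cong (2 +_) (lower-fixes-odd j≤q)

lower≢0 : ∀ q x → x ≢ 0 → lower (suc q) x ≢ 0
lower≢0 q zero          x≢0 _  = x≢0 refl
lower≢0 q (suc zero)    x≢0 ()
lower≢0 q (suc (suc x)) x≢0 ()

-- The positions 0 and 2q+2 lie beyond the ends of the path.  Moving them
-- inwards by one edge places every vertex off the path beside an edge of it.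
clamp-layout : ∀ {q} {G : Graph n} → Layout G (suc q) →
  Σ[ L ∈ Layout G (suc q) ] (2 ≤ suc q → ∀ j {u} → Layout.pos L u ≡ j * 2 → 0 < j × j < suc q)
clamp-layout {n} {q} {G} L = clamped , inner
  where
  open Layout L
  position : Fin n → ℕ
  position u = lower q (raise (pos u))

  position-odd : ∀ j {u} → position u ≡ suc (j * 2) → pos u ≡ suc (j * 2)
  position-odd j {u} eq = raise-odd (pos u) j (lower-odd q (raise (pos u)) j eq)

  clamped : Layout G (suc q)
  clamped = record
    { pos    = position
    ; onto   = λ j<p → let u , eq = onto j<p in
                 u , trans (cong (lower q ∘ raise) eq) (lower-fixes-odd (≤-pred j<p))
    ; bound  = λ u → m≤n⇒m≤1+n (lower-bound q _)
    ; inj    = λ j eq eq′ → inj j (position-odd j eq) (position-odd j eq′)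
    ; near   = λ a → lower-near q _ _ (raise-near (near a))
    ; simple = λ i j u≢v eq eq′ → simple i j u≢v (position-odd i eq) (position-odd j eq′)
    }

  inner : 2 ≤ suc q → ∀ j {u} → position u ≡ j * 2 → 0 < j × j < suc q
  inner (s≤s (s≤s {n = q′} _)) zero    {u} eq = contradiction eq (lower≢0 q′ (raise (pos u)) (raise≢0 (pos u)))
  inner (s≤s (s≤s _))          (suc j) {u} eq =
    s≤s z≤n , s≤s (halve-≤ (subst (_≤ suc (q * 2)) eq (lower-bound q (raise (pos u)))))

-- For m at least 1, the largest multiplicity that a layout and the bound m permit between distinct
-- vertices at positions x and y.
weight : ℕ → ℕ → ℕ → ℕ
weight m x y with x ≤? 2 + y | y ≤? 2 + x | parity x | parity y
... | yes _ | yes _ | inj₂ _ | inj₂ _ = 1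
... | yes _ | yes _ | inj₂ _ | inj₁ _ = m
... | yes _ | yes _ | inj₁ _ | _      = m
... | yes _ | no _  | _      | _      = 0
... | no _  | _     | _      | _      = 0

weight-sym : ∀ m x y → weight m x y ≡ weight m y x
weight-sym m x y with x ≤? 2 + y | y ≤? 2 + x | parity x | parity y
... | yes _ | yes _ | inj₂ _ | inj₂ _ = refl
... | yes _ | yes _ | inj₂ _ | inj₁ _ = refl
... | yes _ | yes _ | inj₁ _ | inj₁ _ = refl
... | yes _ | yes _ | inj₁ _ | inj₂ _ = refl
... | yes _ | no _  | _      | _      = refl
... | no _  | yes _ | _      | _      = refl
... | no _  | no _  | _      | _      = refl

weight-near : ∀ m x y → 0 < weight m x y → x ≤ 2 + y
weight-near m x y lt with x ≤? 2 + y
... | yes le = le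

weight-≤ : ∀ m x y → 1 ≤ m → weight m x y ≤ m
weight-≤ m x y 1≤m with x ≤? 2 + y | y ≤? 2 + x | parity x | parity y
... | yes _ | yes _ | inj₂ _ | inj₂ _ = 1≤m
... | yes _ | yes _ | inj₂ _ | inj₁ _ = ≤-refl
... | yes _ | yes _ | inj₁ _ | _      = ≤-refl
... | yes _ | no _  | _      | _      = z≤n
... | no _  | _     | _      | _      = z≤n

weight-odd-≤ : ∀ m {x y} i j → x ≡ suc (i * 2) → y ≡ suc (j * 2) → weight m x y ≤ 1
weight-odd-≤ m {x} {y} i j ex ey with x ≤? 2 + y | y ≤? 2 + x | parity x | parity y
... | yes _ | yes _ | inj₂ _       | inj₂ _       = ≤-refl
... | yes _ | yes _ | inj₂ _       | inj₁ (b , eq) = contradiction (trans (sym ey) eq) (odd≢even j b)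
... | yes _ | yes _ | inj₁ (a , eq) | _            = contradiction (trans (sym ex) eq) (odd≢even i a)
... | yes _ | no _  | _            | _            = z≤n
... | no _  | _     | _            | _            = z≤n

weight-even : ∀ m {x y} j → x ≡ j * 2 → x ≤ 2 + y → y ≤ 2 + x → weight m x y ≡ m
weight-even m {x} {y} j eq le ge with x ≤? 2 + y | y ≤? 2 + x | parity x | parity y
... | yes _ | yes _ | inj₁ _       | _ = refl
... | yes _ | yes _ | inj₂ (i , ei) | _ = contradiction (trans (sym ei) eq) (odd≢even i j)
... | yes _ | no ¬g | _            | _ = contradiction ge ¬g
... | no ¬l | _     | _            | _ = contradiction le ¬l

weight-> : ∀ m {x y} → 1 ≤ m → x ≤ 2 + y → y ≤ 2 + x → 1 ≤ weight m x y
weight-> m {x} {y} 1≤m le ge with x ≤? 2 + y | y ≤? 2 + x | parity x | parity y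
... | yes _ | yes _ | inj₂ _ | inj₂ _ = ≤-refl
... | yes _ | yes _ | inj₂ _ | inj₁ _ = 1≤m
... | yes _ | yes _ | inj₁ _ | _      = 1≤m
... | yes _ | no ¬g | _      | _      = contradiction ge ¬g
... | no ¬l | _     | _      | _      = contradiction le ¬l

module Saturation (m : ℕ) (1≤m : 1 ≤ m) {q : ℕ} (G : Graph n) (mult≤m : ∀ u v → mult G u v ≤ m)
  (L₀ : Layout G (suc q)) where

  private
    L = proj₁ (clamp-layout L₀)
  open Layout L

  saturation : Graph n
  saturation = record
    { nonEmpty = nonEmpty G
    ; mult     = μ
    ; mult-sym = μ-sym
    ; loopless = μ-loopless
    }
    where
    μ : Fin n → Fin n → ℕ
    μ u v with u Fin.≟ v
    ... | yes _ = 0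
    ... | no  _ = weight m (pos u) (pos v)
    μ-sym : ∀ u v → μ u v ≡ μ v u
    μ-sym u v with u Fin.≟ v | v Fin.≟ u
    ... | yes _   | yes _   = refl
    ... | no _    | no _    = weight-sym m (pos u) (pos v)
    ... | yes u≡v | no v≢u  = contradiction (sym u≡v) v≢u
    ... | no u≢v  | yes v≡u = contradiction (sym v≡u) u≢v
    μ-loopless : ∀ u → μ u u ≡ 0
    μ-loopless u with u Fin.≟ u
    ... | yes _  = refl
    ... | no u≢u = contradiction refl u≢u

  mult-saturation : ∀ {u v} → u ≢ v → mult saturation u v ≡ weight m (pos u) (pos v)
  mult-saturation {u} {v} u≢v with u Fin.≟ v
  ... | yes u≡v = contradiction u≡v u≢v
  ... | no _    = refl

  saturation≤m : ∀ u v → mult saturation u v ≤ m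
  saturation≤m u v with u Fin.≟ v
  ... | yes _ = z≤n
  ... | no _  = weight-≤ m (pos u) (pos v) 1≤m

  mult≤weight : ∀ {u v} → u ≢ v → mult G u v ≤ weight m (pos u) (pos v)
  mult≤weight {u} {v} u≢v with mult G u v in eq
  ... | zero  = z≤n
  ... | suc k = subst (_≤ weight m (pos u) (pos v)) eq (bounded (parity (pos u)) (parity (pos v)))
    where
    adj : Adjacent G u v
    adj = subst (0 <_) (sym eq) (s≤s z≤n)
    bounded : Parity (pos u) → Parity (pos v) → mult G u v ≤ weight m (pos u) (pos v)
    bounded (inj₁ (a , ea)) _ =
      subst (mult G u v ≤_) (sym (weight-even m a ea (near adj) (near′ adj))) (mult≤m u v)
    bounded (inj₂ _) (inj₁ (b , eb)) =
      subst (mult G u v ≤_) (trans (sym (weight-even m b eb (near′ adj) (near adj)))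
        (weight-sym m (pos v) (pos u))) (mult≤m u v)
    bounded (inj₂ (a , ea)) (inj₂ (b , eb)) =
      ≤-trans (simple a b u≢v ea eb) (weight-> m 1≤m (near adj) (near′ adj))

  ⊆-saturation : ∀ u v → mult G u v ≤ mult saturation u v
  ⊆-saturation u v with u Fin.≟ v
  ... | yes refl = ≤-reflexive (loopless G u)
  ... | no u≢v   = mult≤weight u≢v

  saturated : SaturatedLayout m (suc q) saturation
  saturated = record
    { layout = record
      { pos    = pos
      ; onto   = onto
      ; bound  = bound
      ; inj    = inj
      ; near   = λ {u} {v} → near-saturation u v
      ; simple = λ i j {u} {v} u≢v eq eq′ → subst (_≤ 1) (sym (mult-saturation u≢v))
                   (weight-odd-≤ m i j eq eq′)
      }
    ; linked = λ j {u} {v} eq eq′ → subst (0 <_) (sym (mult-saturation (distinct j eq eq′)))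
                 (weight-> m 1≤m (≤-reflexive (trans eq (cong (2 +_) (sym eq′))))
                   (≤-trans (≤-trans (≤-reflexive eq′) (m≤n+m _ 2)) (≤-trans (≤-reflexive (sym eq)) (m≤n+m _ 2))))
    ; filled = λ j u≢v eq le ge → trans (mult-saturation u≢v) (weight-even m j eq le ge)
    ; inner  = proj₂ (clamp-layout L₀)
    }
    where
    near-saturation : ∀ u v → Adjacent saturation u v → pos u ≤ 2 + pos v
    near-saturation u v a with u Fin.≟ v
    ... | no _ = weight-near m (pos u) (pos v) a

saturated-≅ : ∀ {m p} {G : Graph n} {H : Graph n′} → H ≅ G → SaturatedLayout m p G → SaturatedLayout m p H
saturated-≅ {G = G} {H} H≅G S = record
  { layout = layout-⊆ vertices↔ (λ x y → ≤-reflexive (sym (mult-≡ x y))) layout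
  ; linked = λ j eq eq′ → subst (0 <_) (mult-≡ _ _) (linked j eq eq′)
  ; filled = λ j x≢y eq le ge → trans (sym (mult-≡ _ _)) (filled j (x≢y ∘ to-injective) eq le ge)
  ; inner  = λ 2≤p j eq → inner 2≤p j eq
  }
  where
  open SaturatedLayout S
  open _≅_ H≅G
  open Injection (↔⇒↣ vertices↔) using () renaming (injective to to-injective)

≅-sym : {G : Graph n} {H : Graph n′} → G ≅ H → H ≅ G
≅-sym {G = G} {H} G≅H = record
  { vertices↔ = ↔-sym vertices↔
  ; mult-≡    = λ u v → trans (sym (mult-≡ (from u) (from v)))
                  (cong₂ (mult H) (strictlyInverseˡ u) (strictlyInverseˡ v))
  }
  where
  open _≅_ G≅H
  open Inverse vertices↔

-- The parade of a saturated layout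

module Parade {m q : ℕ} {G : Graph n} (S : SaturatedLayout m (suc q) G) where

  open SaturatedLayout S

  private
    end = proj₁ (onto (s≤s z≤n))
    end≡1 : pos end ≡ 1
    end≡1 = proj₂ (onto (s≤s z≤n))

  -- The segment of the path from position 2j+1 down to position 1, with everything about it that a
  -- single induction on j has to carry.
  record Line (j : ℕ) : Set where
    field
      {start}   : Fin n
      start-pos : pos start ≡ suc (j * 2)
      path      : Walk G start end
      size      : #vertices path ≡ suc j
      geodesic  : Geodesic G path
      covers    : ∀ i {x} → i ≤ j → pos x ≡ suc (i * 2) → x ∈ vertices path
      on-path   : ∀ {x} → x ∈ vertices path → ∃[ i ] pos x ≡ suc (i * 2)
      edges     : ∀ i {a b} → i < j → pos a ≡ suc (suc i * 2) → pos b ≡ suc (i * 2) →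
                    (∀ (e : Edge G a b) → EdgeOf G path e) × (∀ (e : Edge G b a) → EdgeOf G path e)

  -- Each edge lowers the position by at most 2, and the walk ends at position 1.
  walk-size : ∀ {x} (W : Walk G x end) → pos x < #vertices W * 2
  walk-size ε       = s≤s (≤-reflexive end≡1)
  walk-size (e ◅ W) = s≤s (≤-trans (near (≤-<-trans z≤n (Fin.toℕ<n e))) (s≤s (walk-size W)))

  walk-size-odd : ∀ j {x} → pos x ≡ suc (j * 2) → (W : Walk G x end) → suc j ≤ #vertices W
  walk-size-odd j eq W = halve-≤ (m≤n⇒m≤1+n (subst (_< #vertices W * 2) eq (walk-size W)))

  simple-Edge : ∀ i j {a b} → a ≢ b → pos a ≡ suc (i * 2) → pos b ≡ suc (j * 2) →
    (e : Edge G a b) → toℕ e ≡ 0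
  simple-Edge i j a≢b eq eq′ e = n<1⇒n≡0 (<-≤-trans (Fin.toℕ<n e) (simple i j a≢b eq eq′))

  extend : ∀ j {u} → pos u ≡ suc (suc j * 2) → Line j → Line (suc j)
  extend j {u} u-pos tail = record
    { start-pos = u-pos
    ; path      = f ◅ path
    ; size      = cong suc size
    ; geodesic  = λ W → subst (_≤ #vertices W) (cong suc (sym size)) (walk-size-odd (suc j) u-pos W) ,
                        λ eq → only W (trans eq (cong suc size))
    ; covers    = covers-u
    ; on-path   = λ where
                    (here refl) → suc j , u-pos
                    (there x∈)  → on-path x∈
    ; edges     = edges-u
    }
    where
    open Line tail
    u≢start : u ≢ start
    u≢start = distinct j u-pos start-pos
    f : Edge G u start
    f = fromℕ< (linked j u-pos start-pos)

    -- A competitor of equal length must descend by 2 at once: `near` bounds its second position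
    -- from below, `walk-size` of the rest from above. So its second vertex is `start`, reached by
    -- the only edge.
    only : (W : Walk G u end) → #vertices W ≡ suc (suc j) → W ≡ f ◅ path
    only ε       ()
    only (_◅_ {j = y} e W) eq = finish (inj j y-pos start-pos) e W (suc-injective eq)
      where
      lower-y : suc (j * 2) ≤ pos y
      lower-y = ≤-pred (≤-pred (subst (_≤ 2 + pos y) u-pos (near (≤-<-trans z≤n (Fin.toℕ<n e)))))
      upper-y : pos y ≤ suc (j * 2)
      upper-y = ≤-pred (subst (λ k → pos y < k * 2) (suc-injective eq) (walk-size W))
      y-pos : pos y ≡ suc (j * 2)
      y-pos = ≤-antisym upper-y lower-y
      finish : ∀ {y} → y ≡ start → (e : Edge G u y) (W : Walk G y end) → #vertices W ≡ suc j →
        _≡_ {A = Walk G u end} (e ◅ W) (f ◅ path)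
      finish refl e W eq = cong₂ _◅_
        (≤1⇒Fin-prop (simple (suc j) j u≢start u-pos start-pos) e f)
        (proj₂ (geodesic W) (trans eq (sym size)))

    covers-u : ∀ i {x} → i ≤ suc j → pos x ≡ suc (i * 2) → x ∈ vertices (f ◅ path)
    covers-u i i≤ eq with m≤n⇒m<n∨m≡n i≤
    ... | inj₁ i<   = there (covers i (≤-pred i<) eq)
    ... | inj₂ refl = here (inj (suc j) eq u-pos)

    -- Consecutive path vertices are joined by a single edge, so both of its traversals have index
    -- 0, like f.
    edges-u : ∀ i {a b} → i < suc j → pos a ≡ suc (suc i * 2) → pos b ≡ suc (i * 2) →
      (∀ (e : Edge G a b) → EdgeOf G (f ◅ path) e) × (∀ (e : Edge G b a) → EdgeOf G (f ◅ path) e)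
    edges-u i {a} {b} i< ea eb with m≤n⇒m<n∨m≡n (≤-pred i<)
    ... | inj₁ i<j  = let there₁ , there₂ = edges i i<j ea eb in
      (λ e → inj₂ (there₁ e)) , (λ e → inj₂ (there₂ e))
    ... | inj₂ refl =
      (λ e → inj₁ (inj₁ (a≡u , b≡start) ,
        trans (simple-Edge (suc j) j (distinct j ea eb) ea eb e) (sym f≡0))) ,
      (λ e → inj₁ (inj₂ (b≡start , a≡u) ,
        trans (simple-Edge j (suc j) (distinct j ea eb ∘ sym) eb ea e) (sym f≡0)))
      where
      a≡u = inj (suc j) ea u-pos
      b≡start = inj j eb start-pos
      f≡0 = simple-Edge (suc j) j u≢start u-pos start-pos f

  line : ∀ j → j < suc q → Line j
  line zero _ = record
    { start-pos = end≡1
    ; path      = ε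
    ; size      = refl
    ; geodesic  = λ W → 0<#vertices G W , trivial W
    ; covers    = λ where zero _ eq → here (inj 0 eq end≡1)
    ; on-path   = λ where (here refl) → 0 , end≡1
    ; edges     = λ _ ()
    }
    where
    trivial : (W : Walk G end end) → #vertices W ≡ 1 → W ≡ ε
    trivial ε       _  = refl
    trivial (e ◅ W) eq = contradiction (suc-injective eq) (>⇒≢ (0<#vertices G W))
  line (suc j) j<p = extend j (proj₂ (onto j<p)) (line j (<-trans (n<1+n j) j<p))
  open Line (line q ≤-refl) public

  module _ (longest : ∀ {x y} (Q : Walk G x y) → IsUniqueShortestPath G Q → #vertices Q ≤ suc q) where

    isParade : IsParade G path
    isParade = record
      { isUniqueShortestPath = geodesic⇒usp G geodesic
      ; longest = λ Q usp → subst (#vertices Q ≤_) (sym size) (longest Q usp)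
      }

  outside : ∀ {x} → x ∉ vertices path → ∃[ a ] pos x ≡ a * 2
  outside {x} x∉ with parity (pos x)
  ... | inj₁ even     = even
  ... | inj₂ (i , eq) = contradiction (covers i (≤-pred (odd-bound i eq)) eq) x∉

  -- The only possible path neighbours of a vertex at 2a are at 2a-1 and 2a+1.
  beside : ∀ {x c} a i → pos x ≡ a * 2 → pos c ≡ suc (i * 2) → Adjacent G x c → a ≤ suc i × i ≤ a
  beside a i ex ec adj =
    halve-≤ (subst₂ (λ k l → k ≤ 2 + l) ex ec (near adj)) ,
    halve-≤ (≤-pred (subst₂ (λ k l → k ≤ 2 + l) ec ex (near′ adj)))

  crowded : 1 ≤ m → 2 ≤ suc q → IsCrowded G path
  crowded 1≤m 2≤p = record
    { two-neighbours   = two-neighbours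
    ; common-neighbour = common-neighbour
    }
    where
    adjacent : ∀ j {u v} → u ≢ v → pos u ≡ j * 2 → pos u ≤ 2 + pos v → pos v ≤ 2 + pos u → Adjacent G u v
    adjacent j u≢v eq le ge = subst (0 <_) (sym (filled j u≢v eq le ge)) 1≤m

    two-neighbours : ∀ x → x ∉ vertices path →
      ∃[ a ] ∃[ b ] a ∈ vertices path × b ∈ vertices path × a ≢ b
        × Adjacent G x a × Adjacent G x b
        × (∀ c → c ∈ vertices path → Adjacent G x c → c ≡ a ⊎ c ≡ b)
        × Adjacent G a b
    two-neighbours x x∉ with outside x∉
    -- At position 0 there would be only one path vertex within reach; `inner` excludes this.
    ... | zero , ex = contradiction (proj₁ (inner 2≤p 0 ex)) λ ()
    ... | suc k , ex = b , a , b∈ , a∈ ,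
        distinct k eb ea ,
        adjacent (suc k) (∉⇒≢ b∈) ex
          (subst₂ (λ s t → s ≤ 2 + t) (sym ex) (sym eb) (≤-trans (n≤1+n _) (m≤n+m _ 2)))
          (subst₂ (λ s t → s ≤ 2 + t) (sym eb) (sym ex) (n≤1+n _)) ,
        adjacent (suc k) (∉⇒≢ a∈) ex
          (subst₂ (λ s t → s ≤ 2 + t) (sym ex) (sym ea) (n≤1+n _))
          (subst₂ (λ s t → s ≤ 2 + t) (sym ea) (sym ex) (s≤s (m≤n+m _ 3))) ,
        only , linked k eb ea
      where
      k<p : suc k < suc q
      k<p = proj₂ (inner 2≤p (suc k) ex)
      a = proj₁ (onto (<-trans (n<1+n k) k<p))
      ea = proj₂ (onto (<-trans (n<1+n k) k<p))
      b = proj₁ (onto k<p)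
      eb = proj₂ (onto k<p)
      a∈ = covers k (<⇒≤ (≤-pred k<p)) ea
      b∈ = covers (suc k) (≤-pred k<p) eb
      ∉⇒≢ : ∀ {c} → c ∈ vertices path → x ≢ c
      ∉⇒≢ c∈ refl = x∉ c∈
      only : ∀ c → c ∈ vertices path → Adjacent G x c → c ≡ b ⊎ c ≡ a
      only c c∈ adj with on-path c∈
      ... | i , ec with beside (suc k) i ex ec adj
      ...   | s≤s k≤i , i≤ with m≤n⇒m<n∨m≡n i≤
      ...     | inj₂ refl = inj₁ (inj (suc k) ec eb)
      ...     | inj₁ i<   with ≤-antisym k≤i (≤-pred i<)
      ...       | refl = inj₂ (inj k ec ea)

    -- If c is path vertex i, then x and y are each at 2i or 2i+2, hence near each other.
    common-neighbour : ∀ x y → x ∉ vertices path → y ∉ vertices path → x ≢ y →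
      ∀ c → c ∈ vertices path → Adjacent G x c → Adjacent G y c → Adjacent G x y
    common-neighbour x y x∉ y∉ x≢y c c∈ xc yc =
      let a , ex = outside x∉
          b , ey = outside y∉
          i , ec = on-path c∈
          a≤ , i≤a = beside a i ex ec xc
          b≤ , i≤b = beside b i ey ec yc
      in adjacent a x≢y ex
        (subst₂ (λ s t → s ≤ 2 + t) (sym ex) (sym ey) (double-≤ (≤-trans a≤ (s≤s i≤b))))
        (subst₂ (λ s t → s ≤ 2 + t) (sym ey) (sym ex) (double-≤ (≤-trans b≤ (s≤s i≤a))))

  edge-distinct : ∀ {a b} → Edge G a b → a ≢ b
  edge-distinct {a} e refl = contradiction (subst Fin (loopless G a) e) λ ()

  -- Adjacent path vertices are consecutive and their single edge lies on the path. Any other edge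
  -- meets an even position, where `filled` applies.
  isSaturated : IsSaturated G m path
  isSaturated {a} {b} e e∉ = either (parity (pos a)) (parity (pos b))
    where
    adj : Adjacent G a b
    adj = ≤-<-trans z≤n (Fin.toℕ<n e)
    a≢b : a ≢ b
    a≢b = edge-distinct e
    path-edge : ∀ i j → pos a ≡ suc (i * 2) → pos b ≡ suc (j * 2) → EdgeOf G path e
    path-edge i j ea eb with differ-by-one {i} {j} (λ { refl → a≢b (inj i ea eb) })
      (odd-near {i} {j} (subst₂ (λ s t → s ≤ 2 + t) ea eb (near adj)))
      (odd-near {j} {i} (subst₂ (λ s t → s ≤ 2 + t) eb ea (near′ adj)))
    ... | inj₁ refl = proj₁ (edges j (≤-pred (odd-bound (suc j) ea)) ea eb) e
    ... | inj₂ refl = proj₂ (edges i (≤-pred (odd-bound (suc i) eb)) eb ea) e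
    either : Parity (pos a) → Parity (pos b) → mult G a b ≡ m
    either (inj₁ (i , ea)) _ = filled i a≢b ea (near adj) (near′ adj)
    either (inj₂ _) (inj₁ (j , eb)) =
      trans (mult-sym G a b) (filled j (a≢b ∘ sym) eb (near′ adj) (near adj))
    either (inj₂ (i , ea)) (inj₂ (j , eb)) = contradiction (path-edge i j ea eb) e∉

-- From saturated layouts to minor maximal graphs.

saturatedCrowdedParade : ∀ {m q} {G : Graph n} → 1 ≤ m → SaturatedLayout m (suc q) G →
  (∀ {x y} (Q : Walk G x y) → IsUniqueShortestPath G Q → #vertices Q ≤ suc q) →
  SaturatedCrowdedParade m (suc q) G
saturatedCrowdedParade {q = suc q} 1≤m S longest =
  _ , _ , path , isParade longest , size , crowded 1≤m (s≤s (s≤s z≤n)) , isSaturated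
  where open Parade S
-- For p = 1 all positions are at most 2, so any two vertices are near, and only one vertex has an
-- odd position.
saturatedCrowdedParade {m = m} {zero} {G} 1≤m S longest u v u≢v =
  pair (parity (pos u)) (parity (pos v))
  where
  open SaturatedLayout S
  pair : Parity (pos u) → Parity (pos v) → mult G u v ≡ m
  pair (inj₁ (i , eu)) _ = filled i u≢v eu (m≤n⇒m≤n+o _ (bound u)) (m≤n⇒m≤n+o _ (bound v))
  pair (inj₂ _) (inj₁ (j , ev)) = trans (mult-sym G u v)
    (filled j (u≢v ∘ sym) ev (m≤n⇒m≤n+o _ (bound v)) (m≤n⇒m≤n+o _ (bound u)))
  pair (inj₂ (i , eu)) (inj₂ (j , ev)) with odd-bound i eu | odd-bound j ev
  ... | s≤s z≤n | s≤s z≤n = contradiction (inj 0 eu ev) u≢v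

-- A longer unique shortest path would give X a spectator number below the
-- spectator floor of G.
usp-bound : ∀ {k} {G X : Graph n} → k ≤ n →
  (∀ {h} (H : Graph h) s → G ≼ H → HasSpectatorNumber H s → k ≤ s) → G ≼ X →
  ∀ {x y} (Q : Walk X x y) → IsUniqueShortestPath X Q → #vertices Q ≤ n ∸ k
usp-bound {n} {k} {G} {X} k≤n floor G≼X Q usp =
  ≮⇒≥ λ lt → impossible n Q usp lt (m<m+n n (0<#vertices X Q))
  where
  -- Q need not be a parade, so d measures the room left for longer paths. Any longer unique
  -- shortest path is refuted at a smaller d; hence Q is a parade, and its spectator number is below
  -- k.
  impossible : ∀ d {x y} (Q : Walk X x y) → IsUniqueShortestPath X Q →
    n ∸ k < #vertices Q → n < d + #vertices Q → ⊥
  impossible zero    Q usp lt far = <⇒≱ far (path-length X (IsUniqueShortestPath.isPath usp))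
  impossible (suc d) Q usp lt far = <⇒≱ sp<k (floor X (n ∸ #vertices Q) G≼X
    (#vertices Q , (_ , _ , Q , parade , refl) , refl))
    where
    sp<k : n ∸ #vertices Q < k
    sp<k = subst (n ∸ #vertices Q <_) (m∸[m∸n]≡n k≤n)
      (∸-monoʳ-< lt (path-length X (IsUniqueShortestPath.isPath usp)))
    parade : IsParade X Q
    parade = record
      { isUniqueShortestPath = usp
      ; longest = λ Q′ usp′ → ≮⇒≥ λ Q<Q′ → impossible d Q′ usp′ (<-trans lt Q<Q′)
          (<-≤-trans far (≤-trans (≤-reflexive (sym (+-suc d _))) (+-monoʳ-≤ d Q<Q′)))
      }

-- The length p is a variable with an equation because it has to be matched as `suc q`, which
-- `n ∸ k` does not allow.
maximal⇒saturatedCrowded : ∀ {k m p} (G : Graph n) → k ≤ n → 1 ≤ m → p ≡ n ∸ k → 0 < p → Layout G p →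
  MinorMaximal (InClass n m k) G → SaturatedCrowdedParade m p G
maximal⇒saturatedCrowded {n} {k} {m} {suc q} G k≤n 1≤m p≡ _ L ((_ , mult≤m , _ , floor) , maximal) =
  saturatedCrowdedParade 1≤m (saturated-≅ (≅-sym X≅G) saturated) (bound (iso (≅-refl G)))
  where
  open Saturation m 1≤m G mult≤m L
  X = saturation

  G≼X : G ≼ X
  G≼X = ⊆⇒≼ (↔-id _) ⊆-saturation

  bound : ∀ {Y : Graph n} → G ≼ Y → ∀ {x y} (Q : Walk Y x y) → IsUniqueShortestPath Y Q → #vertices Q ≤ suc q
  bound G≼Y Q usp = subst (#vertices Q ≤_) (sym p≡) (usp-bound k≤n floor G≼Y Q usp)

  X≅G : X ≅ G
  X≅G = maximal X (refl , saturation≤m ,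
    -- X attains the floor itself, as its parade has n-k vertices. Graphs with X as a minor also
    -- have G as a minor, so none goes below k.
    (n , X , iso (≅-refl X) , suc q ,
      (_ , _ , Parade.path saturated , Parade.isParade saturated (bound G≼X) , Parade.size saturated) ,
      trans (sym (m∸[m∸n]≡n k≤n)) (cong (n ∸_) (sym p≡))) ,
    λ H s X≼H → floor H s (⊆-≼-trans {G = G} ⊆-saturation X≼H)) G≼X

theorem7p6 : ∀ (n k m : ℕ) →
    (k + 2 ≤ n × 1 ≤ m) ⊎ (k + 1 ≡ n × 2 ≤ m) →
    ∀ {n′ : ℕ} (G : Graph n′) →
    MinorMaximal (InClass n m k) G →
    SaturatedCrowdedParade m (n ∸ k) G
theorem7p6 n k m small G G-max@((refl , _ , (h , H , G≼H , _ , (_ , _ , P , P-parade , refl) , k≡) , _) , _) =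
  maximal⇒saturatedCrowded G (<⇒≤ k<n) 1≤m refl (m<n⇒0<n∸m k<n) (minor-layout k G≼H layout-H) G-max
  where
  k<n : k < n
  k<n = [ (λ (le , _) → <-≤-trans (m<m+n k (s≤s z≤n)) le) ,
          (λ (eq , _) → ≤-reflexive (trans (+-comm 1 k) eq)) ]′ small
  1≤m : 1 ≤ m
  1≤m = [ proj₂ , (λ (_ , le) → <⇒≤ le) ]′ small
  usp = IsParade.isUniqueShortestPath P-parade
  -- Since P has at most h vertices, the truncated difference can be inverted: `h ∸ k` is the number
  -- of vertices of P.
  layout-H : Layout H (h ∸ k)
  layout-H = subst (Layout H)
    (sym (trans (cong (h ∸_) k≡) (m∸[m∸n]≡n (path-length H (IsUniqueShortestPath.isPath usp)))))
    (GeodesicLayout.layout H P (usp⇒geodesic H usp))
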